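{- Let $L:[1,\infty)\to[1,\infty)$ be any function. For every integer $r\ge2$, setting $K:=r^2$ gives $$\Gamma_L(K)\le\frac1r=K^{ -1/2}.$$ Consequently, let $\gamma:[1,\infty)\to[0,1]$ be a function such that, for every $K\ge1$ and every $n\geq 1$, every nonempty $B\subseteq\mathbb F_2^n$ with $E(B)\ge\frac1K|B|^3$ contains a nonempty $Y\subseteq B$ satisfying $$|Y+Y|\le L(K)|Y|,\qquad|Y|\ge\gamma(K)|B|.$$ Then, for $K=r^2$ with $r\ge2$ an integer, $$\gamma(K)\le K^{ -1/2}.$$ Moreover, for such $K=r^2$ and $\eta\ge0$, a positive universal lower bound for $|A\cap Y|/|A|$ inferred only from $Y\subseteq B$, $|Y|\ge\gamma(K)|B|$ and $|A\triangle B|\le\eta|A|$ (that is, a constant $c>0$ such that $|A\cap Y|\ge c|A|$ for all $n$ and all $A,B,Y\subseteq\mathbb F_2^n$, $A\ne\varnothing$, satisfying these three conditions) can hold only when $$\eta<\frac{\gamma(K)}{1-\gamma(K)}\le\frac1{r-1}=\frac1{\sqrt K-1}.$$ In particular, the contamination scale $\eta$ for which such a positive bound holds is at most $(1+o_{K\to\infty}(1))K^{ -1/2}$ along the sequence $K=r^2$.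
   Context: For $S,T\subseteq\mathbb F_2^n$, $S+T=\{s+t:s\in S,t\in T\}$; $\triangle$ is symmetric difference. $E(S)=|\{(x_1,x_2,x_3,x_4)\in S^4:x_1+x_2=x_3+x_4\}|$ is the additive energy. For $K\ge1$ define $$\Gamma_L(K):=\inf_{\substack{n\ge1,\ \varnothing\ne S\subseteq\mathbb F_2^n\\ E(S)\ge K^{ -1}|S|^3}}\ \max_{\substack{\varnothing\ne Y\subseteq S\\ |Y+Y|\le L(K)|Y|}}\frac{|Y|}{|S|}.$$ -}

module Defs where

open import Axiom.ExcludedMiddle using (ExcludedMiddle)
open import Data.Bool.Base using (Bool; true; false; T; not; _∧_; _xor_)
import Data.Bool.Properties as Bool
open import Data.Integer.Base as ℤ using (+_)
import Data.Integer.Properties as ℤ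
open import Data.Integer.Solver using () renaming (module +-*-Solver to ℤSolver)
open import Data.Bool.ListAction using (any)
open import Data.List.Base
  using (List; []; _∷_; length; filter; filterᵇ; cartesianProduct; cartesianProductWith)
open import Data.List.Membership.Propositional using () renaming (_∈_ to _∈ˡ_)
import Data.List.Membership.Propositional.Properties as Mem
open import Data.List.Relation.Unary.Any using (here; there)
open import Data.Nat.Coprimality using (1-coprimeTo)
open import Data.Nat.Base as ℕ using (ℕ; zero; suc)
import Data.Nat.Properties as ℕ
open import Data.Product.Base using (Σ; ∃; _×_; _,_; proj₁; proj₂)
open import Data.Rational.Base as ℚ using (ℚ; 0ℚ; 1ℚ; ½; ∣_∣)
import Data.Rational.Properties as ℚ
open import Data.Rational.Solver using (module +-*-Solver)
import Data.Rational.Unnormalised.Base as ℚᵘ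
import Data.Rational.Unnormalised.Properties as ℚᵘ
open import Data.Sum.Base using (inj₁; inj₂)
open import Data.Vec.Base using (Vec; []; _∷_; zipWith)
import Data.Vec.Properties as Vec
open import Function.Bundles using (Func; _⟨$⟩_)
open import Level using (0ℓ)
open import Relation.Binary.Bundles using (Setoid)
import Relation.Binary.Construct.On as On
open import Relation.Binary.Definitions using (DecidableEquality)
open import Relation.Binary.PropositionalEquality
  using (_≡_; refl; sym; trans; cong; cong₂; subst; subst₂)
open import Relation.Nullary.Decidable using (T?; ⌊_⌋; yes; no)
open import Relation.Nullary.Negation using (¬_; contradiction)

private
  variable
    n : ℕ

-- Reals are Cauchy sequences of rationals up to _≃_; functions between sets
-- of reals are setoid maps (Func), i.e. they respect _≃_.

Cauchy : (ℕ → ℚ) → Set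
Cauchy s = ∀ ε → 0ℚ ℚ.< ε →
  ∃ λ N → ∀ m n → N ℕ.≤ m → N ℕ.≤ n → ∣ s m ℚ.- s n ∣ ℚ.≤ ε

record ℝ : Set where
  constructor mkℝ
  field
    seq    : ℕ → ℚ
    cauchy : Cauchy seq

open ℝ public

infix 4 _≤_ _<_ _≃_

_≤_ _<_ _≃_ : ℝ → ℝ → Set
x ≤ y = ∀ ε → 0ℚ ℚ.< ε → ∃ λ N → ∀ n → N ℕ.≤ n → seq x n ℚ.≤ seq y n ℚ.+ ε
x < y = ∃ λ ε → 0ℚ ℚ.< ε × ∃ λ N → ∀ n → N ℕ.≤ n → seq x n ℚ.+ ε ℚ.≤ seq y n
x ≃ y = x ≤ y × y ≤ x

private
  half-pos : ∀ {ε} → 0ℚ ℚ.< ε → 0ℚ ℚ.< ½ ℚ.* ε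
  half-pos {ε} 0<ε = subst (ℚ._< ½ ℚ.* ε) (ℚ.*-zeroʳ ½) (ℚ.*-monoʳ-<-pos ½ 0<ε)

  half+half : ∀ ε → ½ ℚ.* ε ℚ.+ ½ ℚ.* ε ≡ ε
  half+half ε = trans (sym (ℚ.*-distribʳ-+ ε ½ ½)) (ℚ.*-identityˡ ε)

  *-pos : ∀ {p q} → 0ℚ ℚ.< p → 0ℚ ℚ.< q → 0ℚ ℚ.< p ℚ.* q
  *-pos {p} {q} 0<p 0<q =
    ℚ.positive⁻¹ _ {{ℚ.pos*pos⇒pos p {{ℚ.positive 0<p}} q {{ℚ.positive 0<q}}}}

  ⊔-≤ˡ : ∀ {a b c} → a ℕ.⊔ b ℕ.≤ c → a ℕ.≤ c
  ⊔-≤ˡ {a} {b} = ℕ.m⊔n≤o⇒m≤o a b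

  ⊔-≤ʳ : ∀ {a b c} → a ℕ.⊔ b ℕ.≤ c → b ℕ.≤ c
  ⊔-≤ʳ {a} {b} = ℕ.m⊔n≤o⇒n≤o a b

≤-refl : ∀ {x} → x ≤ x
≤-refl {x} ε 0<ε = 0 , λ n _ →
  ℚ.≤-trans (ℚ.≤-reflexive (sym (ℚ.+-identityʳ (seq x n)))) (ℚ.+-monoʳ-≤ (seq x n) (ℚ.<⇒≤ 0<ε))

≤-trans : ∀ {x y z} → x ≤ y → y ≤ z → x ≤ z
≤-trans {x} {y} {z} x≤y y≤z ε 0<ε
  with x≤y (½ ℚ.* ε) (half-pos 0<ε) | y≤z (½ ℚ.* ε) (half-pos 0<ε)
... | M , p | N , q = M ℕ.⊔ N , λ n h → begin
  seq x n                                   ≤⟨ p n (⊔-≤ˡ h) ⟩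
  seq y n ℚ.+ ½ ℚ.* ε                       ≤⟨ ℚ.+-monoˡ-≤ _ (q n (⊔-≤ʳ {M} h)) ⟩
  seq z n ℚ.+ ½ ℚ.* ε ℚ.+ ½ ℚ.* ε           ≡⟨ ℚ.+-assoc (seq z n) _ _ ⟩
  seq z n ℚ.+ (½ ℚ.* ε ℚ.+ ½ ℚ.* ε)         ≡⟨ cong (seq z n ℚ.+_) (half+half ε) ⟩
  seq z n ℚ.+ ε                             ∎
  where open ℚ.≤-Reasoning

ℝ-setoid : Setoid 0ℓ 0ℓ
ℝ-setoid = record
  { Carrier       = ℝ
  ; _≈_           = _≃_
  ; isEquivalence = record
    { refl  = λ {x} → ≤-refl {x} , ≤-refl {x}
    ; sym   = λ (p , q) → q , p
    ; trans = λ {x} {y} {z} (p , q) (p′ , q′) →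
                ≤-trans {x} {y} {z} p p′ , ≤-trans {z} {y} {x} q′ q
    }
  }

fromℚ : ℚ → ℝ
fromℚ q = mkℝ (λ _ → q) λ ε 0<ε → 0 , λ _ _ _ _ →
  subst (ℚ._≤ ε) (cong ∣_∣ (sym (ℚ.+-inverseʳ q))) (ℚ.<⇒≤ 0<ε)

fromℕ : ℕ → ℝ
fromℕ m = fromℚ (+ m ℚ./ 1)

0ℝ 1ℝ : ℝ
0ℝ = fromℚ 0ℚ
1ℝ = fromℚ 1ℚ

ratio : ℕ → (d : ℕ) → 0 ℕ.< d → ℝ
ratio m d 0<d = fromℚ (ℚ._/_ (+ m) d {{ℕ.>-nonZero 0<d}})

infix  8 -_
infixl 7 _*_ _÷_[_]
infixl 6 _+_ _-_

_+_ : ℝ → ℝ → ℝ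
mkℝ s cs + mkℝ t ct = mkℝ (λ n → s n ℚ.+ t n) λ ε 0<ε →
  let M , p = cs (½ ℚ.* ε) (half-pos 0<ε)
      N , q = ct (½ ℚ.* ε) (half-pos 0<ε)
  in M ℕ.⊔ N , λ m n hm hn → begin
    ∣ (s m ℚ.+ t m) ℚ.- (s n ℚ.+ t n) ∣
      ≡⟨ cong ∣_∣ (rearrange (s m) (t m) (s n) (t n)) ⟩
    ∣ (s m ℚ.- s n) ℚ.+ (t m ℚ.- t n) ∣
      ≤⟨ ℚ.∣p+q∣≤∣p∣+∣q∣ (s m ℚ.- s n) (t m ℚ.- t n) ⟩
    ∣ s m ℚ.- s n ∣ ℚ.+ ∣ t m ℚ.- t n ∣
      ≤⟨ ℚ.+-mono-≤ (p m n (⊔-≤ˡ hm) (⊔-≤ˡ hn)) (q m n (⊔-≤ʳ {M} hm) (⊔-≤ʳ {M} hn)) ⟩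
    ½ ℚ.* ε ℚ.+ ½ ℚ.* ε
      ≡⟨ half+half ε ⟩
    ε ∎
  where
  open ℚ.≤-Reasoning
  rearrange : ∀ a b c d → (a ℚ.+ b) ℚ.- (c ℚ.+ d) ≡ (a ℚ.- c) ℚ.+ (b ℚ.- d)
  rearrange = solve 4 (λ a b c d → (a :+ b) :- (c :+ d) := (a :- c) :+ (b :- d)) refl
    where open +-*-Solver

-_ : ℝ → ℝ
- mkℝ s cs = mkℝ (λ n → ℚ.- s n) λ ε 0<ε →
  let N , p = cs ε 0<ε
  in N , λ m n hm hn →
    subst (ℚ._≤ ε)
      (trans (sym (ℚ.∣-p∣≡∣p∣ (s m ℚ.- s n))) (cong ∣_∣ (ℚ.neg-distrib-+ (s m) (ℚ.- s n))))
      (p m n hm hn)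

_-_ : ℝ → ℝ → ℝ
x - y = x + (- y)

private
  Bounded : (ℕ → ℚ) → Set
  Bounded s = ∃ λ b → 0ℚ ℚ.< b × ∃ λ N → ∀ n → N ℕ.≤ n → ∣ s n ∣ ℚ.≤ b

  bounded : ∀ s → Cauchy s → Bounded s
  bounded s cs with cs 1ℚ (ℚ.positive⁻¹ 1ℚ)
  ... | N , p = 1ℚ ℚ.+ ∣ s N ∣
    , ℚ.<-≤-trans (ℚ.positive⁻¹ 1ℚ)
        (subst (ℚ._≤ 1ℚ ℚ.+ ∣ s N ∣) (ℚ.+-identityʳ 1ℚ) (ℚ.+-monoʳ-≤ 1ℚ (ℚ.0≤∣p∣ (s N))))
    , N , λ n h → begin
      ∣ s n ∣                             ≡⟨ cong ∣_∣ (rearrange (s n) (s N)) ⟩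
      ∣ (s n ℚ.- s N) ℚ.+ s N ∣           ≤⟨ ℚ.∣p+q∣≤∣p∣+∣q∣ (s n ℚ.- s N) (s N) ⟩
      ∣ s n ℚ.- s N ∣ ℚ.+ ∣ s N ∣         ≤⟨ ℚ.+-monoˡ-≤ _ (p n N h ℕ.≤-refl) ⟩
      1ℚ ℚ.+ ∣ s N ∣                      ∎
    where
    open ℚ.≤-Reasoning
    rearrange : ∀ a b → a ≡ (a ℚ.- b) ℚ.+ b
    rearrange = solve 2 (λ a b → a := (a :- b) :+ b) refl
      where open +-*-Solver

  -- A δ with b * δ = ε.
  shrink : ∀ b ε → 0ℚ ℚ.< b → 0ℚ ℚ.< ε → ∃ λ δ → 0ℚ ℚ.< δ × b ℚ.* δ ≡ ε
  shrink b ε 0<b 0<ε = b⁻¹ ℚ.* ε , *-pos 0<b⁻¹ 0<ε , (begin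
    b ℚ.* (b⁻¹ ℚ.* ε)   ≡⟨ sym (ℚ.*-assoc b b⁻¹ ε) ⟩
    b ℚ.* b⁻¹ ℚ.* ε     ≡⟨ cong (ℚ._* ε) (ℚ.*-inverseʳ b {{nz}}) ⟩
    1ℚ ℚ.* ε            ≡⟨ ℚ.*-identityˡ ε ⟩
    ε                   ∎)
    where
    open Relation.Binary.PropositionalEquality.≡-Reasoning
    nz = ℚ.>-nonZero 0<b
    b⁻¹ = ℚ.1/_ b {{nz}}
    0<b⁻¹ : 0ℚ ℚ.< b⁻¹
    0<b⁻¹ = ℚ.positive⁻¹ b⁻¹ {{ℚ.1/pos⇒pos b {{ℚ.positive 0<b}}}}

  *-mono-≤ : ∀ {a b c d} → 0ℚ ℚ.≤ b → 0ℚ ℚ.≤ c →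
             a ℚ.≤ b → c ℚ.≤ d → a ℚ.* c ℚ.≤ b ℚ.* d
  *-mono-≤ {a} {b} {c} {d} 0≤b 0≤c a≤b c≤d = ℚ.≤-trans
    (ℚ.*-monoʳ-≤-nonNeg c {{ℚ.nonNegative 0≤c}} a≤b)
    (ℚ.*-monoˡ-≤-nonNeg b {{ℚ.nonNegative 0≤b}} c≤d)

_*_ : ℝ → ℝ → ℝ
mkℝ s cs * mkℝ t ct = mkℝ (λ n → s n ℚ.* t n) λ ε 0<ε →
  let b , 0<b , B , s≤b = bounded s cs
      c , 0<c , C , t≤c = bounded t ct
      δ , 0<δ , cδ≡     = shrink c (½ ℚ.* ε) 0<c (half-pos 0<ε)
      η , 0<η , bη≡     = shrink b (½ ℚ.* ε) 0<b (half-pos 0<ε)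
      M , p             = cs δ 0<δ
      N , q             = ct η 0<η
  in (B ℕ.⊔ C) ℕ.⊔ (M ℕ.⊔ N) , λ m n hm hn →
    let hmB = ⊔-≤ˡ {B} (⊔-≤ˡ {B ℕ.⊔ C} hm)
        hnC = ⊔-≤ʳ {B} (⊔-≤ˡ {B ℕ.⊔ C} hn)
        hmM = ⊔-≤ˡ {M} (⊔-≤ʳ {B ℕ.⊔ C} hm)
        hnM = ⊔-≤ˡ {M} (⊔-≤ʳ {B ℕ.⊔ C} hn)
        hmN = ⊔-≤ʳ {M} (⊔-≤ʳ {B ℕ.⊔ C} hm)
        hnN = ⊔-≤ʳ {M} (⊔-≤ʳ {B ℕ.⊔ C} hn)
    in begin
    ∣ s m ℚ.* t m ℚ.- s n ℚ.* t n ∣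
      ≡⟨ cong ∣_∣ (rearrange (s m) (t m) (s n) (t n)) ⟩
    ∣ s m ℚ.* (t m ℚ.- t n) ℚ.+ t n ℚ.* (s m ℚ.- s n) ∣
      ≤⟨ ℚ.∣p+q∣≤∣p∣+∣q∣ (s m ℚ.* (t m ℚ.- t n)) (t n ℚ.* (s m ℚ.- s n)) ⟩
    ∣ s m ℚ.* (t m ℚ.- t n) ∣ ℚ.+ ∣ t n ℚ.* (s m ℚ.- s n) ∣
      ≡⟨ cong₂ ℚ._+_ (ℚ.∣p*q∣≡∣p∣*∣q∣ (s m) (t m ℚ.- t n)) (ℚ.∣p*q∣≡∣p∣*∣q∣ (t n) (s m ℚ.- s n)) ⟩
    ∣ s m ∣ ℚ.* ∣ t m ℚ.- t n ∣ ℚ.+ ∣ t n ∣ ℚ.* ∣ s m ℚ.- s n ∣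
      ≤⟨ ℚ.+-mono-≤
           (*-mono-≤ (ℚ.<⇒≤ 0<b) (ℚ.0≤∣p∣ (t m ℚ.- t n)) (s≤b m hmB) (q m n hmN hnN))
           (*-mono-≤ (ℚ.<⇒≤ 0<c) (ℚ.0≤∣p∣ (s m ℚ.- s n)) (t≤c n hnC) (p m n hmM hnM)) ⟩
    b ℚ.* η ℚ.+ c ℚ.* δ
      ≡⟨ cong₂ ℚ._+_ bη≡ cδ≡ ⟩
    ½ ℚ.* ε ℚ.+ ½ ℚ.* ε
      ≡⟨ half+half ε ⟩
    ε ∎
  where
  open ℚ.≤-Reasoning
  rearrange : ∀ a b c d → a ℚ.* b ℚ.- c ℚ.* d ≡ a ℚ.* (b ℚ.- d) ℚ.+ d ℚ.* (a ℚ.- c)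
  rearrange = solve 4 (λ a b c d → a :* b :- c :* d := a :* (b :- d) :+ d :* (a :- c)) refl
    where open +-*-Solver

private
  ⊔-pos : ∀ p {ε} → 0ℚ ℚ.< ε → 0ℚ ℚ.< p ℚ.⊔ ε
  ⊔-pos p {ε} 0<ε = ℚ.<-≤-trans 0<ε (ℚ.p≤q⊔p p ε)

-- If x ≥ ε > 0 from index N on, the terms are 1 / max (x n) ε, which is
-- everywhere defined and equals 1 / x n from N on.
recip : (x : ℝ) → 0ℝ < x → ℝ
recip (mkℝ s cs) (ε , 0<ε , N , s≥ε) = mkℝ inv λ ε′ 0<ε′ →
  let δ , 0<δ , eq = shrink (k ℚ.* k) ε′ (*-pos 0<k 0<k) 0<ε′
      M , p        = cs δ 0<δ
  in N ℕ.⊔ M , λ m n hm hn → begin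
    ∣ inv m ℚ.- inv n ∣
      ≡⟨ cong ∣_∣ (difference m n) ⟩
    ∣ inv m ℚ.* inv n ℚ.* (d n ℚ.- d m) ∣
      ≡⟨ ℚ.∣p*q∣≡∣p∣*∣q∣ (inv m ℚ.* inv n) (d n ℚ.- d m) ⟩
    ∣ inv m ℚ.* inv n ∣ ℚ.* ∣ d n ℚ.- d m ∣
      ≡⟨ cong (ℚ._* ∣ d n ℚ.- d m ∣) (ℚ.0≤p⇒∣p∣≡p (ℚ.<⇒≤ (*-pos (0<inv m) (0<inv n)))) ⟩
    inv m ℚ.* inv n ℚ.* ∣ d n ℚ.- d m ∣
      ≡⟨ cong₂ (λ a b → inv m ℚ.* inv n ℚ.* ∣ a ℚ.- b ∣) (d≡s n (⊔-≤ˡ {N} hn)) (d≡s m (⊔-≤ˡ {N} hm)) ⟩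
    inv m ℚ.* inv n ℚ.* ∣ s n ℚ.- s m ∣
      ≤⟨ *-mono-≤ (ℚ.<⇒≤ (*-pos 0<k 0<k)) (ℚ.0≤∣p∣ (s n ℚ.- s m))
           (*-mono-≤ (ℚ.<⇒≤ 0<k) (ℚ.<⇒≤ (0<inv n)) (inv≤k m) (inv≤k n))
           (p n m (⊔-≤ʳ {N} hn) (⊔-≤ʳ {N} hm)) ⟩
    k ℚ.* k ℚ.* δ
      ≡⟨ eq ⟩
    ε′ ∎
  where
  open ℚ.≤-Reasoning
  d : ℕ → ℚ
  d n = s n ℚ.⊔ ε
  0<d : ∀ n → 0ℚ ℚ.< d n
  0<d n = ⊔-pos (s n) 0<ε
  inv : ℕ → ℚ
  inv n = ℚ.1/_ (d n) {{ℚ.>-nonZero (0<d n)}}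
  k : ℚ
  k = ℚ.1/_ ε {{ℚ.>-nonZero 0<ε}}
  0<k : 0ℚ ℚ.< k
  0<k = ℚ.positive⁻¹ k {{ℚ.1/pos⇒pos ε {{ℚ.positive 0<ε}}}}
  0<inv : ∀ n → 0ℚ ℚ.< inv n
  0<inv n = ℚ.positive⁻¹ (inv n) {{ℚ.1/pos⇒pos (d n) {{ℚ.positive (0<d n)}}}}
  d≡s : ∀ n → N ℕ.≤ n → d n ≡ s n
  d≡s n h = ℚ.p≥q⇒p⊔q≡p (subst (ℚ._≤ s n) (ℚ.+-identityˡ ε) (s≥ε n h))
  d*inv : ∀ n → d n ℚ.* inv n ≡ 1ℚ
  d*inv n = ℚ.*-inverseʳ (d n) {{ℚ.>-nonZero (0<d n)}}
  inv≤k : ∀ n → inv n ℚ.≤ k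
  inv≤k n = begin
    inv n                     ≡⟨ sym (ℚ.*-identityʳ (inv n)) ⟩
    inv n ℚ.* 1ℚ              ≡⟨ cong (inv n ℚ.*_) (sym (ℚ.*-inverseʳ ε {{ℚ.>-nonZero 0<ε}})) ⟩
    inv n ℚ.* (ε ℚ.* k)       ≤⟨ ℚ.*-monoˡ-≤-nonNeg (inv n) {{ℚ.nonNegative (ℚ.<⇒≤ (0<inv n))}}
                                   (ℚ.*-monoʳ-≤-nonNeg k {{ℚ.nonNegative (ℚ.<⇒≤ 0<k)}} (ℚ.p≤q⊔p (s n) ε)) ⟩
    inv n ℚ.* (d n ℚ.* k)     ≡⟨ sym (ℚ.*-assoc (inv n) (d n) k) ⟩
    inv n ℚ.* d n ℚ.* k       ≡⟨ cong (ℚ._* k) (trans (ℚ.*-comm (inv n) (d n)) (d*inv n)) ⟩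
    1ℚ ℚ.* k                  ≡⟨ ℚ.*-identityˡ k ⟩
    k                         ∎
  rearrange : ∀ a b u v → u ℚ.* v ℚ.* (b ℚ.- a) ≡ u ℚ.* (b ℚ.* v) ℚ.- v ℚ.* (a ℚ.* u)
  rearrange = solve 4 (λ a b u v → u :* v :* (b :- a) := u :* (b :* v) :- v :* (a :* u)) refl
    where open +-*-Solver
  difference : ∀ m n → inv m ℚ.- inv n ≡ inv m ℚ.* inv n ℚ.* (d n ℚ.- d m)
  difference m n = sym (trans (rearrange (d m) (d n) (inv m) (inv n))
    (cong₂ ℚ._-_
      (trans (cong (inv m ℚ.*_) (d*inv n)) (ℚ.*-identityʳ (inv m)))
      (trans (cong (inv n ℚ.*_) (d*inv m)) (ℚ.*-identityʳ (inv n)))))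

_÷_[_] : ℝ → (y : ℝ) → 0ℝ < y → ℝ
x ÷ y [ 0<y ] = x * recip y 0<y

0<-from-1≤ : ∀ {x} → 1ℝ ≤ x → 0ℝ < x
0<-from-1≤ {x} 1≤x with 1≤x ½ (ℚ.positive⁻¹ ½)
... | N , p = ½ , ℚ.positive⁻¹ ½ , N , λ n h →
  subst (½ ℚ.≤_) (cancel (seq x n)) (ℚ.+-monoˡ-≤ (ℚ.- ½) (p n h))
  where
  cancel : ∀ a → a ℚ.+ ½ ℚ.- ½ ≡ a
  cancel a = trans (ℚ.+-assoc a ½ (ℚ.- ½)) (ℚ.+-identityʳ a)

-- √x for x > 0, specified as the positive number with square x rather than
-- constructed.
record PositiveSqrt (x : ℝ) : Set where
  field
    √     : ℝ
    0<√   : 0ℝ < √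
    √*√≃x : √ * √ ≃ x

IsMaximum IsInfimum : (ℝ → Set) → ℝ → Set
IsMaximum P m = P m × (∀ v → P v → v ≤ m)
IsInfimum P g = (∀ v → P v → g ≤ v) × (∀ b → (∀ v → P v → b ≤ v) → b ≤ g)

TendsTo0 : (ℕ → ℝ) → Set
TendsTo0 o = ∀ ε → 0ℝ < ε → ∃ λ R → ∀ r → R ℕ.≤ r → - ε ≤ o r × o r ≤ ε

[1,∞⟩ [0,1] : Setoid 0ℓ 0ℓ
[1,∞⟩ = On.setoid {B = ∃ λ x → 1ℝ ≤ x} ℝ-setoid proj₁
[0,1] = On.setoid {B = ∃ λ x → 0ℝ ≤ x × x ≤ 1ℝ} ℝ-setoid proj₁

ℝ≥1 : Set
ℝ≥1 = Setoid.Carrier [1,∞⟩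

-- 𝔽₂ is Bool, with _xor_ as addition; subsets of 𝔽₂ⁿ are characteristic functions.

𝔽₂^_ : ℕ → Set
𝔽₂^ n = Vec Bool n

infixl 6 _⊕_ _⊞_
infix  4 _≟_ _∈_ _⊆_

_⊕_ : 𝔽₂^ n → 𝔽₂^ n → 𝔽₂^ n
_⊕_ = zipWith _xor_

_≟_ : DecidableEquality (𝔽₂^ n)
_≟_ = Vec.≡-dec Bool._≟_

vectors : ∀ n → List (𝔽₂^ n)
vectors zero    = [] ∷ []
vectors (suc n) = cartesianProductWith _∷_ (false ∷ true ∷ []) (vectors n)

Subset : ℕ → Set
Subset n = 𝔽₂^ n → Bool

_∈_ : 𝔽₂^ n → Subset n → Set
x ∈ S = T (S x)

_⊆_ : Subset n → Subset n → Set
S ⊆ S′ = ∀ x → x ∈ S → x ∈ S′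

Nonempty : Subset n → Set
Nonempty S = ∃ λ x → x ∈ S

_∩_ _△_ _⊞_ : Subset n → Subset n → Subset n

elements : Subset n → List (𝔽₂^ n)
elements {n} S = filterᵇ S (vectors n)

(S ∩ S′) x = S x ∧ S′ x
(S △ S′) x = S x xor S′ x
(S ⊞ S′) x = any (λ s → any (λ t → ⌊ s ⊕ t ≟ x ⌋) (elements S′)) (elements S)

card : Subset n → ℕ
card S = length (elements S)

E : Subset n → ℕ
E S = length (filter (λ (x₁ , x₂ , x₃ , x₄) → x₁ ⊕ x₂ ≟ x₃ ⊕ x₄)
  (cartesianProduct s (cartesianProduct s (cartesianProduct s s))))
  where s = elements S

0<card : (S : Subset n) → Nonempty S → 0 ℕ.< card S
0<card S (x , x∈S) = nonempty⇒0< (Mem.∈-filter⁺ (λ y → T? (S y)) (complete x) x∈S)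
  where
  bools : ∀ b → b ∈ˡ false ∷ true ∷ []
  bools false = here refl
  bools true  = there (here refl)
  complete : ∀ {n} (x : 𝔽₂^ n) → x ∈ˡ vectors n
  complete []      = here refl
  complete (b ∷ x) = Mem.∈-cartesianProductWith⁺ _∷_ (bools b) (complete x)
  nonempty⇒0< : ∀ {A : Set} {y : A} {ys} → y ∈ˡ ys → 0 ℕ.< length ys
  nonempty⇒0< (here _)  = ℕ.z<s
  nonempty⇒0< (there _) = ℕ.z<s

-- E(S) ≥ K⁻¹ ∣S∣³
HighEnergy : ℝ≥1 → Subset n → Set
HighEnergy (K , 1≤K) S = recip K (0<-from-1≤ {K} 1≤K) * fromℕ (card S ℕ.^ 3) ≤ fromℕ (E S)

module _ (L : Func [1,∞⟩ [1,∞⟩) (K : ℝ≥1) where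

  SmallDoubling : Subset n → Subset n → Set
  SmallDoubling S Y =
    Nonempty Y × Y ⊆ S × fromℕ (card (Y ⊞ Y)) ≤ proj₁ (L ⟨$⟩ K) * fromℕ (card Y)

  Densities : (S : Subset n) → Nonempty S → ℝ → Set
  Densities S S≠∅ v =
    ∃ λ Y → SmallDoubling S Y × v ≃ ratio (card Y) (card S) (0<card S S≠∅)

  MaxDensities : ℝ → Set
  MaxDensities v = ∃ λ n → 1 ℕ.≤ n × ∃ λ (S : Subset n) → ∃ λ (S≠∅ : Nonempty S) →
    HighEnergy K S × IsMaximum (Densities S S≠∅) v

  -- g is Γ_L(K).  This is a relation because maxima and infima of sets of
  -- reals need not exist constructively; see Γ-exists.
  IsΓ : ℝ → Set
  IsΓ g = IsInfimum MaxDensities g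

Extracts : Func [1,∞⟩ [1,∞⟩ → Func [1,∞⟩ [0,1] → Set
Extracts L γ = ∀ K n → 1 ℕ.≤ n → (B : Subset n) → Nonempty B → HighEnergy K B →
  ∃ λ Y → SmallDoubling L K B Y × proj₁ (γ ⟨$⟩ K) * fromℕ (card B) ≤ fromℕ (card Y)

-- A universal lower bound c for ∣A ∩ Y∣ / ∣A∣, when ∣Y∣ ≥ g ∣B∣ and ∣A △ B∣ ≤ η ∣A∣.
PositiveBound : ℝ → ℝ → Set
PositiveBound g η = ∃ λ c → 0ℝ < c ×
  (∀ n → 1 ℕ.≤ n → (A B Y : Subset n) → Nonempty A →
    Y ⊆ B →
    g * fromℕ (card B) ≤ fromℕ (card Y) →
    fromℕ (card (A △ B)) ≤ η * fromℕ (card A) →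
    c * fromℕ (card A) ≤ fromℕ (card (A ∩ Y)))

-- With excluded middle, Γ_L(K) exists for all L and K.
module _ (em : ExcludedMiddle 0ℓ) where

  private
    open ℚ.≤-Reasoning

    -- 1 / (n + 1)
    step : ℕ → ℚ
    step n = ℚ.mkℚ (+ 1) n (1-coprimeTo (suc n))

    step-anti : ∀ {m n} → m ℕ.≤ n → step n ℚ.≤ step m
    step-anti m≤n = ℚ.*≤* (ℤ.*-monoˡ-≤-nonNeg (+ 1) (ℤ.+≤+ (ℕ.s≤s m≤n)))

    archimedean : ∀ ε → 0ℚ ℚ.< ε → ∃ λ N → step N ℚ.≤ ε
    archimedean (ℚ.mkℚ (+ zero)     _ _) (ℚ.*<* (ℤ.+<+ ()))
    archimedean (ℚ.mkℚ ℤ.-[1+ _ ]   _ _) (ℚ.*<* ())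
    archimedean (ℚ.mkℚ (+ suc a) d _) _ =
      d , ℚ.*≤* (ℤ.*-monoʳ-≤-nonNeg (+ suc d) {+ 1} {+ suc a} (ℤ.+≤+ (ℕ.s≤s ℕ.z≤n)))

    multiple : ℕ → ℚ → ℚ
    multiple zero    q = 0ℚ
    multiple (suc k) q = q ℚ.+ multiple k q

    multiple-step : ∀ n → multiple (suc n) (step n) ≡ 1ℚ
    multiple-step n = ℚ.toℚᵘ-injective
      (ℚᵘ.≃-trans (go (suc n)) (ℚᵘ.*≡* (ℤ.*-comm (+ suc n) (+ 1))))
      where
      expand : ∀ k d → (+ 1 ℤ.* d ℤ.+ k ℤ.* d) ℤ.* d ≡ (+ 1 ℤ.+ k) ℤ.* (d ℤ.* d)
      expand = solve 2 (λ k d → (con (+ 1) :* d :+ k :* d) :* d := (con (+ 1) :+ k) :* (d :* d)) refl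
        where open ℤSolver
      go : ∀ k → ℚ.toℚᵘ (multiple k (step n)) ℚᵘ.≃ ℚᵘ.mkℚᵘ (+ k) n
      go zero    = ℚᵘ.*≡* refl
      go (suc k) = ℚᵘ.≃-trans (ℚ.toℚᵘ-homo-+ (step n) (multiple k (step n)))
        (ℚᵘ.≃-trans (ℚᵘ.+-congʳ (ℚ.toℚᵘ (step n)) (go k)) (ℚᵘ.*≡* (expand (+ k) (+ suc n))))

    +-pos-≤ : ∀ p {ε} → 0ℚ ℚ.< ε → p ℚ.≤ p ℚ.+ ε
    +-pos-≤ p {ε} 0<ε = subst (ℚ._≤ p ℚ.+ ε) (ℚ.+-identityʳ p) (ℚ.+-monoʳ-≤ p (ℚ.<⇒≤ 0<ε))

    fromℚ-mono : ∀ {p q} → p ℚ.≤ q → fromℚ p ≤ fromℚ q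
    fromℚ-mono {q = q} p≤q ε 0<ε = 0 , λ _ _ → ℚ.≤-trans p≤q (+-pos-≤ q 0<ε)

    ≤-from-≤+ε : ∀ {p q} → (∀ ε → 0ℚ ℚ.< ε → p ℚ.≤ q ℚ.+ ε) → p ℚ.≤ q
    ≤-from-≤+ε {p} {q} h = ℚ.≮⇒≥ λ q<p →
      let c , q<c , c<p = ℚ.<-dense q<p
          0<c-q = subst (ℚ._< c ℚ.- q) (ℚ.+-inverseʳ q) (ℚ.+-monoˡ-< (ℚ.- q) q<c)
      in ℚ.<-irrefl refl (ℚ.<-≤-trans c<p (subst (p ℚ.≤_) (cancel c q) (h (c ℚ.- q) 0<c-q)))
      where
      cancel : ∀ c q → q ℚ.+ (c ℚ.- q) ≡ c
      cancel = solve 2 (λ c q → q :+ (c :- q) := c) refl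
        where open +-*-Solver

    fromℚ-cancel : ∀ {p q} → fromℚ p ≤ fromℚ q → p ℚ.≤ q
    fromℚ-cancel p≤q = ≤-from-≤+ε λ ε 0<ε → let N , h = p≤q ε 0<ε in h N ℕ.≤-refl

    p≤∣p∣ : ∀ p → p ℚ.≤ ∣ p ∣
    p≤∣p∣ p with ℚ.≤-total 0ℚ p
    ... | inj₁ 0≤p = ℚ.≤-reflexive (sym (ℚ.0≤p⇒∣p∣≡p 0≤p))
    ... | inj₂ p≤0 = ℚ.≤-trans p≤0 (ℚ.0≤∣p∣ p)

    close : ∀ {p q ε} → ∣ p ℚ.- q ∣ ℚ.≤ ε → p ℚ.≤ q ℚ.+ ε
    close {p} {q} {ε} h = begin
      p                    ≡⟨ cancel p q ⟩
      q ℚ.+ (p ℚ.- q)      ≤⟨ ℚ.+-monoʳ-≤ q (ℚ.≤-trans (p≤∣p∣ (p ℚ.- q)) h) ⟩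
      q ℚ.+ ε              ∎
      where
      cancel : ∀ p q → p ≡ q ℚ.+ (p ℚ.- q)
      cancel = solve 2 (λ p q → p := q :+ (p :- q)) refl
        where open +-*-Solver

    close⁻ : ∀ {p q ε} → p ℚ.≤ q ℚ.+ ε → q ℚ.≤ p ℚ.+ ε → ∣ p ℚ.- q ∣ ℚ.≤ ε
    close⁻ {p} {q} {ε} h k with ℚ.∣p∣≡p∨∣p∣≡-p (p ℚ.- q)
    ... | inj₁ eq = subst (ℚ._≤ ε) (sym eq)
      (subst (p ℚ.- q ℚ.≤_) (cancel q ε) (ℚ.+-monoˡ-≤ (ℚ.- q) h))
      where
      cancel : ∀ q ε → q ℚ.+ ε ℚ.- q ≡ ε
      cancel = solve 2 (λ q ε → q :+ ε :- q := ε) refl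
        where open +-*-Solver
    ... | inj₂ eq = subst (ℚ._≤ ε) (sym (trans eq (flip p q)))
      (subst (q ℚ.- p ℚ.≤_) (cancel p ε) (ℚ.+-monoˡ-≤ (ℚ.- p) k))
      where
      open +-*-Solver
      cancel : ∀ q ε → q ℚ.+ ε ℚ.- q ≡ ε
      cancel = solve 2 (λ q ε → q :+ ε :- q := ε) refl
      flip : ∀ p q → ℚ.- (p ℚ.- q) ≡ q ℚ.- p
      flip = solve 2 (λ p q → :- (p :- q) := q :- p) refl

    halves : ∀ p ε → p ℚ.+ ½ ℚ.* ε ℚ.+ ½ ℚ.* ε ≡ p ℚ.+ ε
    halves p ε = trans (ℚ.+-assoc p (½ ℚ.* ε) (½ ℚ.* ε)) (cong (p ℚ.+_) (half+half ε))

    -- The index depends on x and ε only, not on q.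
    ≤-uniform : ∀ x ε → 0ℚ ℚ.< ε → ∃ λ N → ∀ q → x ≤ fromℚ q → ∀ n → N ℕ.≤ n → seq x n ℚ.≤ q ℚ.+ ε
    ≤-uniform x ε 0<ε with cauchy x (½ ℚ.* ε) (half-pos 0<ε)
    ... | N , c = N , λ q x≤q n N≤n →
      let M , h = x≤q (½ ℚ.* ε) (half-pos 0<ε) in begin
      seq x n                               ≤⟨ close {seq x n} (c n (M ℕ.⊔ N) N≤n (ℕ.m≤n⊔m M N)) ⟩
      seq x (M ℕ.⊔ N) ℚ.+ ½ ℚ.* ε           ≤⟨ ℚ.+-monoˡ-≤ (½ ℚ.* ε) (h (M ℕ.⊔ N) (ℕ.m≤m⊔n M N)) ⟩
      q ℚ.+ ½ ℚ.* ε ℚ.+ ½ ℚ.* ε             ≡⟨ halves q ε ⟩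
      q ℚ.+ ε                               ∎

    ≥-uniform : ∀ x ε → 0ℚ ℚ.< ε → ∃ λ N → ∀ q → fromℚ q ≤ x → ∀ n → N ℕ.≤ n → q ℚ.≤ seq x n ℚ.+ ε
    ≥-uniform x ε 0<ε with cauchy x (½ ℚ.* ε) (half-pos 0<ε)
    ... | N , c = N , λ q q≤x n N≤n →
      let M , h = q≤x (½ ℚ.* ε) (half-pos 0<ε) in begin
      q                                     ≤⟨ h (M ℕ.⊔ N) (ℕ.m≤m⊔n M N) ⟩
      seq x (M ℕ.⊔ N) ℚ.+ ½ ℚ.* ε           ≤⟨ ℚ.+-monoˡ-≤ (½ ℚ.* ε) (close {seq x (M ℕ.⊔ N)} (c (M ℕ.⊔ N) n (ℕ.m≤n⊔m M N) N≤n)) ⟩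
      seq x n ℚ.+ ½ ℚ.* ε ℚ.+ ½ ℚ.* ε       ≡⟨ halves (seq x n) ε ⟩
      seq x n ℚ.+ ε                         ∎

    ≰⇒≥ : ∀ {x q} → ¬ (x ≤ fromℚ q) → fromℚ q ≤ x
    ≰⇒≥ {x} {q} x≰q ε 0<ε with cauchy x (½ ℚ.* ε) (half-pos 0<ε)
    ... | N , c with q ℚ.≤? seq x N ℚ.+ ½ ℚ.* ε
    ... | yes h = N , λ n N≤n → begin
      q                                 ≤⟨ h ⟩
      seq x N ℚ.+ ½ ℚ.* ε               ≤⟨ ℚ.+-monoˡ-≤ (½ ℚ.* ε) (close {seq x N} (c N n ℕ.≤-refl N≤n)) ⟩
      seq x n ℚ.+ ½ ℚ.* ε ℚ.+ ½ ℚ.* ε   ≡⟨ halves (seq x n) ε ⟩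
      seq x n ℚ.+ ε                     ∎
    ... | no ¬h = contradiction
      (λ ε′ 0<ε′ → N , λ n N≤n → begin
        seq x n                 ≤⟨ close {seq x n} (c n N N≤n ℕ.≤-refl) ⟩
        seq x N ℚ.+ ½ ℚ.* ε     ≤⟨ ℚ.<⇒≤ (ℚ.≰⇒> ¬h) ⟩
        q                       ≤⟨ +-pos-≤ q 0<ε′ ⟩
        q ℚ.+ ε′                ∎)
      x≰q

    module _ (P : ℝ → Set) (1∈P : P 1ℝ) (0≤P : ∀ v → P v → 0ℝ ≤ v) where

      Below : ℚ → Set
      Below q = ∀ v → P v → fromℚ q ≤ v

      Within : ℚ → ℚ → Set
      Within δ q = Below q × ∃ λ v → P v × v ≤ fromℚ (q ℚ.+ δ)

      search : ∀ δ → 0ℚ ℚ.< δ → ∀ k q → Below q → 1ℚ ℚ.≤ q ℚ.+ multiple k δ → ∃ (Within δ)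
      search δ 0<δ zero    q b h = q , b , 1ℝ , 1∈P , fromℚ-mono
        (ℚ.≤-trans h (ℚ.+-monoʳ-≤ q (ℚ.<⇒≤ 0<δ)))
      search δ 0<δ (suc k) q b h with em {Below (q ℚ.+ δ)}
      ... | yes b′ = search δ 0<δ k (q ℚ.+ δ) b′ (subst (1ℚ ℚ.≤_) (sym (ℚ.+-assoc q δ (multiple k δ))) h)
      ... | no ¬b′ with em {∃ λ v → P v × v ≤ fromℚ (q ℚ.+ δ)}
      ...   | yes w = q , b , w
      ...   | no ¬w = contradiction (λ v Pv → ≰⇒≥ {v} λ v≤ → ¬w (v , Pv , v≤)) ¬b′

      approx : ∀ n → ∃ (Within (step n))
      approx n = search (step n) (ℚ.positive⁻¹ (step n)) (suc n) 0ℚ 0≤P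
        (ℚ.≤-reflexive (sym (trans (ℚ.+-identityˡ _) (multiple-step n))))

      s : ℕ → ℚ
      s n = proj₁ (approx n)

      s≤s+step : ∀ m n → s m ℚ.≤ s n ℚ.+ step n
      s≤s+step m n =
        let b , _           = proj₂ (approx m)
            _ , v , Pv , v≤ = proj₂ (approx n)
        in fromℚ-cancel (≤-trans {fromℚ (s m)} {v} {fromℚ (s n ℚ.+ step n)} (b v Pv) v≤)

      infimum : ∃ (IsInfimum P)
      infimum = mkℝ s s-cauchy , lower , greatest
        where
        s-cauchy : Cauchy s
        s-cauchy ε 0<ε = let N , h = archimedean ε 0<ε in N , λ m n N≤m N≤n →
          close⁻ {s m} {s n}
            (ℚ.≤-trans (s≤s+step m n) (ℚ.+-monoʳ-≤ (s n) (ℚ.≤-trans (step-anti N≤n) h)))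
            (ℚ.≤-trans (s≤s+step n m) (ℚ.+-monoʳ-≤ (s m) (ℚ.≤-trans (step-anti N≤m) h)))
        lower : ∀ v → P v → mkℝ s s-cauchy ≤ v
        lower v Pv ε 0<ε = let N , h = ≥-uniform v ε 0<ε in N , λ n N≤n →
          h (s n) (proj₁ (proj₂ (approx n)) v Pv) n N≤n
        greatest : ∀ b → (∀ v → P v → b ≤ v) → b ≤ mkℝ s s-cauchy
        greatest b b≤P ε 0<ε =
          let M , h = archimedean (½ ℚ.* ε) (half-pos 0<ε)
              N , k = ≤-uniform b (½ ℚ.* ε) (half-pos 0<ε)
          in M ℕ.⊔ N , λ n hn →
            let _ , v , Pv , v≤ = proj₂ (approx n) in begin
            seq b n
              ≤⟨ k (s n ℚ.+ step n) (≤-trans {b} {v} {fromℚ (s n ℚ.+ step n)} (b≤P v Pv) v≤) n (⊔-≤ʳ {M} hn) ⟩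
            s n ℚ.+ step n ℚ.+ ½ ℚ.* ε
              ≤⟨ ℚ.+-monoˡ-≤ (½ ℚ.* ε) (ℚ.+-monoʳ-≤ (s n) (ℚ.≤-trans (step-anti (⊔-≤ˡ {M} hn)) h)) ⟩
            s n ℚ.+ ½ ℚ.* ε ℚ.+ ½ ℚ.* ε
              ≡⟨ halves (s n) ε ⟩
            s n ℚ.+ ε ∎

    recip≤1 : ∀ x (1≤x : 1ℝ ≤ x) (0<x : 0ℝ < x) → recip x 0<x ≤ 1ℝ
    recip≤1 x 1≤x (ε , 0<ε , _) ε′ 0<ε′ with 1≤x (ε′ ℚ.* ε) (*-pos 0<ε′ 0<ε)
    ... | N , h = N , λ n N≤n →
      let d   = seq x n ℚ.⊔ ε
          0<d = ⊔-pos (seq x n) 0<ε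
          i   = ℚ.1/_ d {{ℚ.>-nonZero 0<d}}
          0<i = ℚ.positive⁻¹ i {{ℚ.1/pos⇒pos d {{ℚ.positive 0<d}}}}
      in begin
      i                              ≡⟨ sym (ℚ.*-identityʳ i) ⟩
      i ℚ.* 1ℚ                       ≤⟨ ℚ.*-monoˡ-≤-nonNeg i {{ℚ.nonNegative (ℚ.<⇒≤ 0<i)}} (h n N≤n) ⟩
      i ℚ.* (seq x n ℚ.+ ε′ ℚ.* ε)   ≤⟨ ℚ.*-monoˡ-≤-nonNeg i {{ℚ.nonNegative (ℚ.<⇒≤ 0<i)}}
                                          (ℚ.+-mono-≤ (ℚ.p≤p⊔q (seq x n) ε)
                                            (ℚ.*-monoˡ-≤-nonNeg ε′ {{ℚ.nonNegative (ℚ.<⇒≤ 0<ε′)}} (ℚ.p≤q⊔p (seq x n) ε))) ⟩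
      i ℚ.* (d ℚ.+ ε′ ℚ.* d)         ≡⟨ rearrange i d ε′ ⟩
      d ℚ.* i ℚ.* (1ℚ ℚ.+ ε′)        ≡⟨ cong (ℚ._* (1ℚ ℚ.+ ε′)) (ℚ.*-inverseʳ d {{ℚ.>-nonZero 0<d}}) ⟩
      1ℚ ℚ.* (1ℚ ℚ.+ ε′)             ≡⟨ ℚ.*-identityˡ (1ℚ ℚ.+ ε′) ⟩
      1ℚ ℚ.+ ε′                      ∎
      where
      rearrange : ∀ i d e → i ℚ.* (d ℚ.+ e ℚ.* d) ≡ d ℚ.* i ℚ.* (1ℚ ℚ.+ e)
      rearrange = solve 3 (λ i d e → i :* (d :+ e :* d) := d :* i :* (con 1ℚ :+ e)) refl
        where open +-*-Solver

    ≤*1 : ∀ {x y} → x ≤ y → x ≤ y * 1ℝ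
    ≤*1 {x} {y} x≤y ε 0<ε = let N , h = x≤y ε 0<ε in N , λ n N≤n →
      subst (λ z → seq x n ℚ.≤ z ℚ.+ ε) (sym (ℚ.*-identityʳ (seq y n))) (h n N≤n)

    *1≤ : ∀ {x y} → x ≤ y → x * 1ℝ ≤ y
    *1≤ {x} {y} x≤y ε 0<ε = let N , h = x≤y ε 0<ε in N , λ n N≤n →
      subst (ℚ._≤ seq y n ℚ.+ ε) (sym (ℚ.*-identityʳ (seq x n))) (h n N≤n)

    -- The subspace {0} of 𝔽₂, whose maximal density is 1.
    point : Subset 1
    point (b ∷ []) = not b

    point≠∅ : Nonempty point
    point≠∅ = false ∷ [] , _

    card≤1 : (Y : Subset 1) → Y ⊆ point → card Y ℕ.≤ 1
    card≤1 Y Y⊆ with Y (false ∷ [])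
    ... | true  with Y (true ∷ []) | Y⊆ (true ∷ [])
    ...   | true  | 1∈ = contradiction _ 1∈
    ...   | false | _  = ℕ.≤-refl
    card≤1 Y Y⊆ | false with Y (true ∷ []) | Y⊆ (true ∷ [])
    ...   | true  | 1∈ = contradiction _ 1∈
    ...   | false | _  = ℕ.z≤n

    1-maxDensity : ∀ L K → MaxDensities L K 1ℝ
    1-maxDensity L K@(k , 1≤k) = 1 , ℕ.≤-refl , point , point≠∅
      , *1≤ {recip k (0<-from-1≤ {k} 1≤k)} {1ℝ} (recip≤1 k 1≤k (0<-from-1≤ {k} 1≤k))
      , ( point
        , (point≠∅ , (λ _ x∈ → x∈) , ≤*1 {1ℝ} {proj₁ (L ⟨$⟩ K)} (proj₂ (L ⟨$⟩ K)))
        , ≤-refl {1ℝ} , ≤-refl {1ℝ} )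
      , λ { v (Y , (_ , Y⊆ , _) , v≤ , _) →
              ≤-trans {v} {ratio (card Y) 1 ℕ.z<s} {1ℝ} v≤ (ratio≤1 (card≤1 Y Y⊆)) }
      where
      ratio≤1 : ∀ {m} → m ℕ.≤ 1 → ratio m 1 ℕ.z<s ≤ 1ℝ
      ratio≤1 ℕ.z≤n           = fromℚ-mono (ℚ.nonNegative⁻¹ 1ℚ)
      ratio≤1 (ℕ.s≤s ℕ.z≤n) = ≤-refl {1ℝ}

    maxDensity≥0 : ∀ L K v → MaxDensities L K v → 0ℝ ≤ v
    maxDensity≥0 L K v (_ , _ , S , S≠∅ , _ , (Y , _ , _ , ≤v) , _) =
      ≤-trans {0ℝ} {ratio (card Y) (card S) (0<card S S≠∅)} {v}
        (0≤ratio (card Y) (card S) (0<card S S≠∅)) ≤v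
      where
      0≤ratio : ∀ m d (0<d : 0 ℕ.< d) → 0ℝ ≤ ratio m d 0<d
      0≤ratio m d 0<d = fromℚ-mono
        (ℚ.nonNegative⁻¹ (ℚ._/_ (+ m) d {{nz}}) {{ℚ.normalize-nonNeg m d {{nz}}}})
        where nz = ℕ.>-nonZero 0<d

  Γ-exists : ∀ L K → ∃ (IsΓ L K)
  Γ-exists L K = infimum (MaxDensities L K) (1-maxDensity L K) (maxDensity≥0 L K)

{-# OPTIONS --safe #-}
-- Let q = 2 ^ m and let S ⊆ 𝔽₂ ^ (r (1 + m)) be the union of r disjoint cosets
-- ("blocks"), one of an m-dimensional subspace in each of r independent summands.
-- Then ∣S∣ = r q and E(S) ≥ r q³ = ∣S∣³ / r². If Y ⊆ S has T elements, t of them in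
-- one block, then the sums of a point inside and a point outside that block are
-- distinct, so t (T ∸ t) ≤ ∣Y + Y∣ ≤ ℓ T; hence either T ≤ q + 2 ℓ, or every block
-- contains at most 2 ℓ points of Y. In both cases T ≤ q + O(1) as m grows, so Y has
-- density at most 1/r + O(1/q).
--
-- For the threshold on η, let B be the whole space, of size Q, and take Y of size
-- about γ Q and A the complement of d ≈ γ Q points of Y. Then A ∩ Y has bounded size,
-- while ∣A △ B∣ = d ≤ η ∣A∣ as soon as η ≥ d / (Q ∸ d) ≈ γ / (1 - γ).
module Submission where

open import Defs
open import Data.Bool.Base using (Bool; true; false; T; not; _xor_)
import Data.Bool.Properties as Bool
open import Data.Empty using (⊥; ⊥-elim)
open import Data.Fin.Base using (Fin; zero; suc)
import Data.Fin.Properties as Fin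
open import Data.Integer.Base as ℤ using (+_)
import Data.Integer.Properties as ℤ
open import Data.List.Base as List
  using (List; []; _∷_; length; map; take; drop; filter; cartesianProduct; allFin)
import Data.List.Properties as List
open import Data.List.Membership.Propositional using (find) renaming (_∈_ to _∈ˡ_)
import Data.List.Membership.Propositional.Properties as Mem
open import Data.List.Relation.Unary.All as All using ([]; _∷_)
open import Data.List.Relation.Unary.AllPairs using ([]; _∷_)
open import Data.List.Relation.Unary.Any as Any using (here; there; any?)
import Data.List.Relation.Unary.Any.Properties as Any
open import Data.List.Relation.Unary.Unique.Propositional using (Unique)
import Data.List.Relation.Unary.Unique.Propositional.Properties as Unique
open import Data.Nat as ℕ using (ℕ; zero; suc)
import Data.Nat.Coprimality as Coprimality
open import Data.Nat.Properties using (m<n⇒0<n; m<n⇒0<n∸m)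
import Data.Nat.Properties as ℕ
open import Data.Nat.Tactic.RingSolver using (solve-∀)
open import Data.Product using (Σ; ∃; _×_; _,_; proj₁; proj₂)
open import Data.Rational.Base as ℚ using (ℚ; 0ℚ; 1ℚ; ½; ∣_∣)
import Data.Rational.Properties as ℚ
open import Data.Rational.Solver using () renaming (module +-*-Solver to ℚSolver)
import Data.Rational.Unnormalised.Base as ℚᵘ
import Data.Rational.Unnormalised.Properties as ℚᵘ
open import Data.Sum.Base using (_⊎_; inj₁; inj₂; [_,_]′)
open import Data.Vec.Base as Vec using ([]; _∷_; _++_; replicate)
import Data.Vec.Properties as Vec
open import Function.Base using (_∘_; id)
open import Function.Bundles using (Func; module Equivalence; _⟨$⟩_)
open import Level using (0ℓ)
open import Relation.Binary.Bundles using (Preorder)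
open import Relation.Binary.PropositionalEquality
  using (_≡_; _≢_; refl; sym; trans; cong; cong₂; subst; subst₂; module ≡-Reasoning)
import Relation.Binary.Reasoning.Preorder
open import Relation.Nullary.Decidable using (Dec; yes; no; T?; ⌊_⌋; toWitness; fromWitness; ¬?)
open import Relation.Nullary.Negation using (¬_; contradiction)

-- The blocks lie in independent summands and have leading coordinate 1, so the projection to one
-- summand separates its block from all the others, which project to 0. This is why the mixed sums
-- are distinct. Constructivity shapes the rest. Small doubling compares an integer with a real
-- multiple of `card Y` and is not decidable in general, so a maximal `Y` is obtained only up to
-- double negation; that suffices, because an upper bound of a real by a rational is stable under
-- double negation. In the second half γ Q can be rounded only to within 2, and a strict inequality
-- of reals asks for an explicit rational gap. Hence the margins: y approximates γ Q, d = y - 4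
-- points are omitted, η D is compared with d + 1 and D γ / (1 - γ) with d + 2, where D = Q - d.
-- From r ≥ 2 comes γ ≤ 1/2, which keeps D above Q / 2, so that c D outgrows the bound 4 on the size
-- of A ∩ Y.

private
  variable
    n : ℕ
    A A′ : Set

-- Counting in lists

-- Pigeonhole by deleting `f x` from `ys`: the other images avoid it, so induction applies to what
-- is left. Injectivity is demanded only on `xs`, since addition, the main application, is injective
-- only on pairs taken from a block and its complement.
length-injection : ∀ {xs : List A} {ys : List A′} (f : A → A′) → Unique xs →
  (∀ {x} → x ∈ˡ xs → f x ∈ˡ ys) →
  (∀ {x y} → x ∈ˡ xs → y ∈ˡ xs → f x ≡ f y → x ≡ y) →
  length xs ℕ.≤ length ys
length-injection f [] into inj = ℕ.z≤n
length-injection {xs = x ∷ xs} f (x∉xs ∷ uniq) into inj with Mem.∈-∃++ (into (here refl))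
... | as , bs , refl = subst (suc (length xs) ℕ.≤_) eq
  (ℕ.s≤s (length-injection f uniq into′ λ p q → inj (there p) (there q)))
  where
  into′ : ∀ {y} → y ∈ˡ xs → f y ∈ˡ as List.++ bs
  into′ y∈ with Mem.∈-++⁻ as (into (there y∈))
  ... | inj₁ fy∈as           = Mem.∈-++⁺ˡ fy∈as
  ... | inj₂ (there fy∈bs)   = Mem.∈-++⁺ʳ as fy∈bs
  ... | inj₂ (here fy≡fx)    = contradiction
    (inj (here refl) (there y∈) (sym fy≡fx)) (All.lookup x∉xs y∈)
  eq : suc (length (as List.++ bs)) ≡ length (as List.++ f x ∷ bs)
  eq = trans (cong suc (List.length-++ as))
    (trans (sym (ℕ.+-suc (length as) (length bs))) (sym (List.length-++ as)))

length-filter-split : ∀ {P : A → Set} (P? : ∀ x → Dec (P x)) xs →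
  length (filter P? xs) ℕ.+ length (filter (¬? ∘ P?) xs) ≡ length xs
length-filter-split P? [] = refl
length-filter-split P? (x ∷ xs) with P? x
... | yes _ = cong suc (length-filter-split P? xs)
... | no  _ = trans (ℕ.+-suc _ _) (cong suc (length-filter-split P? xs))

-- Union bound, peeling off one class at a time: the elements outside class `i` are covered by the
-- remaining indices, and the filtering can only shrink the other classes.
length-covered : ∀ {I : Set} {P : I → A → Set} (P? : ∀ i x → Dec (P i x)) {M} is xs →
  (∀ {x} → x ∈ˡ xs → ∃ λ i → i ∈ˡ is × P i x) →
  (∀ i → length (filter (P? i) xs) ℕ.≤ M) → length xs ℕ.≤ length is ℕ.* M
length-covered P? [] [] cov small = ℕ.z≤n
length-covered P? [] (x ∷ xs) cov small with cov (here refl)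
... | _ , () , _
length-covered {A = A} {P = P} P? {M} (i ∷ is) xs cov small =
  subst (ℕ._≤ M ℕ.+ length is ℕ.* M) (length-filter-split (P? i) xs)
    (ℕ.+-mono-≤ (small i) (length-covered P? is rest cov′ small′))
  where
  rest = filter (¬? ∘ P? i) xs
  cov′ : ∀ {x} → x ∈ˡ rest → ∃ λ j → j ∈ˡ is × P j x
  cov′ x∈ with Mem.∈-filter⁻ (¬? ∘ P? i) {xs = xs} x∈
  ... | x∈xs , ¬Px with cov x∈xs
  ...   | j , here refl , Px = contradiction Px ¬Px
  ...   | j , there j∈ , Px  = j , j∈ , Px
  filter-comm : ∀ {P Q : A → Set} (P? : ∀ x → Dec (P x)) (Q? : ∀ x → Dec (Q x)) zs →
    length (filter P? (filter Q? zs)) ℕ.≤ length (filter P? zs)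
  filter-comm P? Q? [] = ℕ.z≤n
  filter-comm P? Q? (z ∷ zs) with Q? z
  ... | yes _ with P? z
  ...   | yes _ = ℕ.s≤s (filter-comm P? Q? zs)
  ...   | no  _ = filter-comm P? Q? zs
  filter-comm P? Q? (z ∷ zs) | no _ with P? z
  ...   | yes _ = ℕ.m≤n⇒m≤1+n (filter-comm P? Q? zs)
  ...   | no  _ = filter-comm P? Q? zs
  small′ : ∀ j → length (filter (P? j) rest) ℕ.≤ M
  small′ j = ℕ.≤-trans (filter-comm (P? j) (¬? ∘ P? i) xs) (small j)

length-cartesianProduct : ∀ (xs : List A) (ys : List A′) →
  length (cartesianProduct xs ys) ≡ length xs ℕ.* length ys
length-cartesianProduct [] ys = refl
length-cartesianProduct (x ∷ xs) ys = trans (List.length-++ (map (x ,_) ys))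
  (cong₂ ℕ._+_ (List.length-map (x ,_) ys) (length-cartesianProduct xs ys))

-- Cardinality in 𝔽₂ⁿ

∈-vectors : (x : 𝔽₂^ n) → x ∈ˡ vectors n
∈-vectors []          = here refl
∈-vectors (false ∷ x) = Mem.∈-cartesianProductWith⁺ _∷_ {xs = false ∷ true ∷ []} (here refl) (∈-vectors x)
∈-vectors (true ∷ x)  = Mem.∈-cartesianProductWith⁺ _∷_ {xs = false ∷ true ∷ []} (there (here refl)) (∈-vectors x)

vectors-unique : ∀ n → Unique (vectors n)
vectors-unique zero    = [] ∷ []
vectors-unique (suc n) = Unique.cartesianProductWith⁺ _∷_ Vec.∷-injective
  (((λ ()) ∷ []) ∷ [] ∷ []) (vectors-unique n)

length-vectors : ∀ n → length (vectors n) ≡ 2 ℕ.^ n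
length-vectors zero    = refl
length-vectors (suc n) = trans (List.length-++ (map (false ∷_) (vectors n)))
  (cong₂ ℕ._+_ (half false)
    (trans (List.length-++ (map (true ∷_) (vectors n))) (cong (ℕ._+ 0) (half true))))
  where
  half : ∀ b → length (map (b Vec.∷_) (vectors n)) ≡ 2 ℕ.^ n
  half b = trans (List.length-map (b ∷_) (vectors n)) (length-vectors n)

∈-elements⁺ : (S : Subset n) → ∀ {x} → x ∈ S → x ∈ˡ elements S
∈-elements⁺ S {x} = Mem.∈-filter⁺ (T? ∘ S) (∈-vectors x)

∈-elements⁻ : (S : Subset n) → ∀ {x} → x ∈ˡ elements S → x ∈ S
∈-elements⁻ {n} S = proj₂ ∘ Mem.∈-filter⁻ (T? ∘ S) {xs = vectors n}

elements-unique : (S : Subset n) → Unique (elements S)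
elements-unique {n} S = Unique.filter⁺ (T? ∘ S) (vectors-unique n)

card-lower : (S : Subset n) {xs : List (𝔽₂^ n)} → Unique xs → (∀ {x} → x ∈ˡ xs → x ∈ S) →
  length xs ℕ.≤ card S
card-lower S uniq xs⊆S = length-injection id uniq (∈-elements⁺ S ∘ xs⊆S) λ _ _ → id

card-upper : (S : Subset n) (xs : List (𝔽₂^ n)) → (∀ {x} → x ∈ S → x ∈ˡ xs) →
  card S ℕ.≤ length xs
card-upper S xs S⊆xs =
  length-injection id (elements-unique S) (S⊆xs ∘ ∈-elements⁻ S) λ _ _ → id

card-complement : (S : Subset n) → card S ℕ.+ card (not ∘ S) ≡ 2 ℕ.^ n
card-complement {n} S = trans (cong (λ k → card S ℕ.+ k) (go (vectors n)))
  (trans (length-filter-split (T? ∘ S) (vectors n)) (length-vectors n))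
  where
  go : ∀ xs → length (List.filterᵇ (not ∘ S) xs) ≡ length (filter (¬? ∘ T? ∘ S) xs)
  go [] = refl
  go (x ∷ xs) with S x
  ... | true  = go xs
  ... | false = cong suc (go xs)

card⁺⇒Nonempty : (S : Subset n) → 0 ℕ.< card S → Nonempty S
card⁺⇒Nonempty S 0< with elements S | ∈-elements⁻ S
... | x ∷ _ | from = x , from (here refl)

⟦_⟧ : List (𝔽₂^ n) → Subset n
⟦ xs ⟧ x = ⌊ any? (x ≟_) xs ⌋

∈-⟦⟧⁺ : ∀ {xs : List (𝔽₂^ n)} {x} → x ∈ˡ xs → x ∈ ⟦ xs ⟧
∈-⟦⟧⁺ = fromWitness

∈-⟦⟧⁻ : ∀ {xs : List (𝔽₂^ n)} {x} → x ∈ ⟦ xs ⟧ → x ∈ˡ xs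
∈-⟦⟧⁻ = toWitness

card-⟦⟧ : {xs : List (𝔽₂^ n)} → Unique xs → card ⟦ xs ⟧ ≡ length xs
card-⟦⟧ {xs = xs} uniq = ℕ.≤-antisym (card-upper ⟦ xs ⟧ xs ∈-⟦⟧⁻) (card-lower ⟦ xs ⟧ uniq ∈-⟦⟧⁺)

∈-⊞⁺ : (S S′ : Subset n) → ∀ {x y} → x ∈ S → y ∈ S′ → x ⊕ y ∈ S ⊞ S′
∈-⊞⁺ S S′ {x} {y} x∈S y∈S′ = Any.any⁺ _ (Any.map
  (λ { refl → Any.any⁺ _ (Any.map (λ { refl → fromWitness {a? = x ⊕ y ≟ x ⊕ y} refl })
                                  (∈-elements⁺ S′ y∈S′)) })
  (∈-elements⁺ S x∈S))

∈-⊞⁻ : (S S′ : Subset n) → ∀ {z} → z ∈ S ⊞ S′ → ∃ λ x → ∃ λ y → x ∈ S × y ∈ S′ × x ⊕ y ≡ z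
∈-⊞⁻ S S′ {z} z∈ with find (Any.any⁻ _ (elements S) z∈)
... | x , x∈ , any-y with find (Any.any⁻ _ (elements S′) any-y)
...   | y , y∈ , x⊕y≟z = x , y , ∈-elements⁻ S x∈ , ∈-elements⁻ S′ y∈ , toWitness {a? = x ⊕ y ≟ z} x⊕y≟z

-- Group laws of 𝔽₂ⁿ and concatenation of vectors

0ᵛ : 𝔽₂^ n
0ᵛ = replicate _ false

⊕-assoc : (x y z : 𝔽₂^ n) → (x ⊕ y) ⊕ z ≡ x ⊕ (y ⊕ z)
⊕-assoc = Vec.zipWith-assoc Bool.xor-assoc

⊕-identityˡ : (x : 𝔽₂^ n) → 0ᵛ ⊕ x ≡ x
⊕-identityˡ = Vec.zipWith-identityˡ Bool.xor-identityˡ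

⊕-identityʳ : (x : 𝔽₂^ n) → x ⊕ 0ᵛ ≡ x
⊕-identityʳ = Vec.zipWith-identityʳ Bool.xor-identityʳ

⊕-inverse : (x : 𝔽₂^ n) → x ⊕ x ≡ 0ᵛ
⊕-inverse []      = refl
⊕-inverse (b ∷ x) = cong₂ _∷_ (Bool.xor-same b) (⊕-inverse x)

⊕-involutiveˡ : (x y : 𝔽₂^ n) → x ⊕ (x ⊕ y) ≡ y
⊕-involutiveˡ x y = trans (sym (⊕-assoc x x y)) (trans (cong (_⊕ y) (⊕-inverse x)) (⊕-identityˡ y))

⊕-cancelˡ : (x : 𝔽₂^ n) {y z : 𝔽₂^ n} → x ⊕ y ≡ x ⊕ z → y ≡ z
⊕-cancelˡ x {y} {z} eq = trans (sym (⊕-involutiveˡ x y)) (trans (cong (x ⊕_) eq) (⊕-involutiveˡ x z))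

take-++ : ∀ {k} (x : 𝔽₂^ k) (y : 𝔽₂^ n) → Vec.take k (x ++ y) ≡ x
take-++ []      y = refl
take-++ (b ∷ x) y = cong (b ∷_) (take-++ x y)

drop-++ : ∀ {k} (x : 𝔽₂^ k) (y : 𝔽₂^ n) → Vec.drop k (x ++ y) ≡ y
drop-++ []      y = refl
drop-++ (b ∷ x) y = drop-++ x y

replicate-++ : ∀ k l → 0ᵛ {k} ++ 0ᵛ {l} ≡ 0ᵛ {k ℕ.+ l}
replicate-++ zero    l = refl
replicate-++ (suc k) l = cong (false ∷_) (replicate-++ k l)

-- For the smaller factor x one has x + y ≤ 2 y, and y cancels. It is applied to the numbers of
-- points of `Y` inside and outside a block, in increasing order.
factor-bound : ∀ ℓ x y → x ℕ.≤ y → x ℕ.* y ℕ.≤ ℓ ℕ.* (x ℕ.+ y) → x ℕ.≤ 2 ℕ.* ℓ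
factor-bound ℓ x zero    ℕ.z≤n _ = ℕ.z≤n
factor-bound ℓ x (suc y) x≤y h = ℕ.*-cancelʳ-≤ x (2 ℕ.* ℓ) (suc y) (begin
  x ℕ.* suc y               ≤⟨ h ⟩
  ℓ ℕ.* (x ℕ.+ suc y)       ≤⟨ ℕ.*-monoʳ-≤ ℓ (ℕ.+-monoˡ-≤ (suc y) x≤y) ⟩
  ℓ ℕ.* (suc y ℕ.+ suc y)   ≡⟨ double ℓ (suc y) ⟩
  2 ℕ.* ℓ ℕ.* suc y         ∎)
  where
  open ℕ.≤-Reasoning
  double : ∀ ℓ y → ℓ ℕ.* (y ℕ.+ y) ≡ 2 ℕ.* ℓ ℕ.* y
  double = solve-∀

-- Unions of cosets of independent subspaces

-- The coset of the i-th summand of (𝔽₂^ (1 + m))^ r in which the leading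
-- coordinate is 1; the cosets for distinct i are disjoint.
module _ (m : ℕ) where

  embed : ∀ {r} → Fin r → 𝔽₂^ m → 𝔽₂^ (r ℕ.* suc m)
  embed zero    v = (true ∷ v) ++ 0ᵛ
  embed (suc i) v = 0ᵛ {suc m} ++ embed i v

  project : ∀ {r} → Fin r → 𝔽₂^ (r ℕ.* suc m) → 𝔽₂^ (suc m)
  project zero    x = Vec.take (suc m) x
  project (suc i) x = project i (Vec.drop (suc m) x)

  project-⊕ : ∀ {r} (i : Fin r) x y → project i (x ⊕ y) ≡ project i x ⊕ project i y
  project-⊕ zero    x y = Vec.take-zipWith {m = suc m} _xor_ x y
  project-⊕ {suc r} (suc i) x y = trans
    (cong (project i) (Vec.drop-zipWith {m = suc m} _xor_ x y)) (project-⊕ i _ _)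

  project-0 : ∀ {r} (i : Fin r) → project i 0ᵛ ≡ 0ᵛ
  project-0 {suc r} zero = trans (cong (Vec.take (suc m)) (sym (replicate-++ (suc m) (r ℕ.* suc m))))
    (take-++ (0ᵛ {suc m}) 0ᵛ)
  project-0 {suc r} (suc i) = trans
    (cong (project i) (trans (cong (Vec.drop (suc m)) (sym (replicate-++ (suc m) (r ℕ.* suc m))))
      (drop-++ (0ᵛ {suc m}) 0ᵛ)))
    (project-0 i)

  project-embed : ∀ {r} (i : Fin r) v → project i (embed i v) ≡ true ∷ v
  project-embed zero    v = take-++ (true ∷ v) 0ᵛ
  project-embed (suc i) v = trans (cong (project i) (drop-++ (0ᵛ {suc m}) (embed i v)))
    (project-embed i v)

  project-embed-≢ : ∀ {r} {i j : Fin r} v → i ≢ j → project i (embed j v) ≡ 0ᵛ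
  project-embed-≢ {i = zero}  {zero}  v i≢j = contradiction refl i≢j
  project-embed-≢ {i = zero}  {suc j} v i≢j = take-++ (0ᵛ {suc m}) (embed j v)
  project-embed-≢ {i = suc i} {zero}  v i≢j = trans
    (cong (project i) (drop-++ (true ∷ v) 0ᵛ)) (project-0 i)
  project-embed-≢ {i = suc i} {suc j} v i≢j = trans
    (cong (project i) (drop-++ (0ᵛ {suc m}) (embed j v))) (project-embed-≢ v (i≢j ∘ cong suc))

  embed-injective : ∀ {r} (i j : Fin r) v w → embed i v ≡ embed j w → i ≡ j × v ≡ w
  embed-injective i j v w eq with i Fin.≟ j
  ... | yes refl = refl , Vec.∷-injectiveʳ
    (trans (sym (project-embed i v)) (trans (cong (project i) eq) (project-embed i w)))
  ... | no i≢j with trans (sym (project-embed i v)) (trans (cong (project i) eq) (project-embed-≢ w i≢j))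
  ...   | ()

  -- `embed i` is affine rather than linear, because of the leading 1. With two terms on each side
  -- these coordinates cancel, so additive quadruples are preserved.
  embed-⊕ : ∀ {r} (i : Fin r) {a b c d} → a ⊕ b ≡ c ⊕ d →
    embed i a ⊕ embed i b ≡ embed i c ⊕ embed i d
  embed-⊕ zero {a} {b} {c} {d} eq = cong (false ∷_) (trans
    (Vec.zipWith-++ _xor_ a 0ᵛ b 0ᵛ)
    (trans (cong (_++ (0ᵛ ⊕ 0ᵛ)) eq) (sym (Vec.zipWith-++ _xor_ c 0ᵛ d 0ᵛ))))
  embed-⊕ (suc i) {a} {b} {c} {d} eq = trans
    (Vec.zipWith-++ _xor_ (0ᵛ {suc m}) (embed i a) (0ᵛ {suc m}) (embed i b))
    (trans (cong ((0ᵛ ⊕ 0ᵛ) ++_) (embed-⊕ i eq))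
      (sym (Vec.zipWith-++ _xor_ (0ᵛ {suc m}) (embed i c) (0ᵛ {suc m}) (embed i d))))

  module _ (r : ℕ) where

    private
      V = vectors m
      q = 2 ℕ.^ m
      embedᵣ = embed {r}

    blockList : List (𝔽₂^ (r ℕ.* suc m))
    blockList = map (λ (i , v) → embedᵣ i v) (cartesianProduct (allFin r) V)

    blocks : Subset (r ℕ.* suc m)
    blocks = ⟦ blockList ⟧

    embed∈blocks : ∀ i v → embedᵣ i v ∈ blocks
    embed∈blocks i v = ∈-⟦⟧⁺ {xs = blockList} (Mem.∈-map⁺ (λ (i , v) → embedᵣ i v)
      (Mem.∈-cartesianProduct⁺ (Mem.∈-allFin i) (∈-vectors v)))

    blocks⇒embed : ∀ {x} → x ∈ blocks → ∃ λ i → ∃ λ v → x ≡ embedᵣ i v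
    blocks⇒embed x∈ with Mem.∈-map⁻ (λ (i , v) → embedᵣ i v) (∈-⟦⟧⁻ {xs = blockList} x∈)
    ... | (i , v) , _ , eq = i , v , eq

    card-blocks : card blocks ≡ r ℕ.* q
    card-blocks = trans (card-⟦⟧ (Unique.map⁺ inj
        (Unique.cartesianProduct⁺ (Unique.allFin⁺ r) (vectors-unique m))))
      (trans (List.length-map (λ (i , v) → embedᵣ i v) (cartesianProduct (allFin r) V))
        (trans (length-cartesianProduct (allFin r) V)
          (cong₂ ℕ._*_ (List.length-tabulate {n = r} id) (length-vectors m))))
      where
      inj : ∀ {x y : Fin r × 𝔽₂^ m} → embedᵣ (proj₁ x) (proj₂ x) ≡ embedᵣ (proj₁ y) (proj₂ y) → x ≡ y
      inj {i , v} {j , w} eq with embed-injective i j v w eq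
      ... | refl , refl = refl

    -- Only quadruples within one block are counted: three points are free and the fourth, c + (a +
    -- b), is forced, which gives q³ solutions for each of the r blocks.
    energy-blocks : r ℕ.* q ℕ.^ 3 ℕ.≤ E blocks
    energy-blocks = subst (ℕ._≤ E blocks) count
      (length-injection quad
        (Unique.cartesianProduct⁺ (Unique.allFin⁺ r) (Unique.cartesianProduct⁺ V!
          (Unique.cartesianProduct⁺ V! V!)))
        (λ {p} _ → into p) (λ _ _ → inj))
      where
      V! = vectors-unique m
      params = cartesianProduct (allFin r) (cartesianProduct V (cartesianProduct V V))
      X = 𝔽₂^ (r ℕ.* suc m)
      quad : Fin r × 𝔽₂^ m × 𝔽₂^ m × 𝔽₂^ m → X × X × X × X
      quad (i , a , b , c) = embedᵣ i a , embed i b , embed i c , embed i (c ⊕ (a ⊕ b))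
      inj : ∀ {p p′} → quad p ≡ quad p′ → p ≡ p′
      inj {i , a , b , c} {j , a′ , b′ , c′} eq
        with embed-injective i j a a′ (cong proj₁ eq)
           | embed-injective i j b b′ (cong (proj₁ ∘ proj₂) eq)
           | embed-injective i j c c′ (cong (proj₁ ∘ proj₂ ∘ proj₂) eq)
      ... | refl , refl | _ , refl | _ , refl = refl
      el : ∀ i v → embedᵣ i v ∈ˡ elements blocks
      el i v = ∈-elements⁺ blocks (embed∈blocks i v)
      into : ∀ p → quad p ∈ˡ filter (λ (x₁ , x₂ , x₃ , x₄) → x₁ ⊕ x₂ ≟ x₃ ⊕ x₄)
        (let s = elements blocks in cartesianProduct s (cartesianProduct s (cartesianProduct s s)))
      into (i , a , b , c) = Mem.∈-filter⁺ (λ (x₁ , x₂ , x₃ , x₄) → x₁ ⊕ x₂ ≟ x₃ ⊕ x₄)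
        (Mem.∈-cartesianProduct⁺ (el i a) (Mem.∈-cartesianProduct⁺ (el i b)
          (Mem.∈-cartesianProduct⁺ (el i c) (el i (c ⊕ (a ⊕ b))))))
        (embed-⊕ i (sym (⊕-involutiveˡ c (a ⊕ b))))
      count : length params ≡ r ℕ.* q ℕ.^ 3
      count = trans (length-cartesianProduct (allFin r) (cartesianProduct V (cartesianProduct V V)))
        (cong₂ ℕ._*_ (List.length-tabulate {n = r} id)
          (trans (length-cartesianProduct V (cartesianProduct V V)) (cong₂ ℕ._*_ (length-vectors m)
            (trans (length-cartesianProduct V V) (cong₂ ℕ._*_ (length-vectors m)
              (trans (length-vectors m) (sym (ℕ.*-identityʳ q))))))))

    module _ (Y : Subset (r ℕ.* suc m)) (Y⊆ : Y ⊆ blocks) where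

      private
        ys = elements Y

        -- Reading membership off the leading coordinate of the projection makes it decidable; on
        -- points of `blocks` it coincides with lying in the image of `embed i`.
        InBlock : Fin r → 𝔽₂^ (r ℕ.* suc m) → Set
        InBlock i x = T (Vec.head (project i x))

        inBlock? : ∀ i x → Dec (InBlock i x)
        inBlock? i x = T? (Vec.head (project i x))

        inside outside : Fin r → List (𝔽₂^ (r ℕ.* suc m))
        inside  i = filter (inBlock? i) ys
        outside i = filter (¬? ∘ inBlock? i) ys

        embed-InBlock : ∀ i v → InBlock i (embedᵣ i v)
        embed-InBlock i v = subst (T ∘ Vec.head) (sym (project-embed i v)) _

        inside⇒embed : ∀ i {x} → x ∈ˡ inside i → ∃ λ v → x ≡ embedᵣ i v
        inside⇒embed i {x} x∈ with Mem.∈-filter⁻ (inBlock? i) {xs = ys} x∈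
        ... | x∈ys , x∈i with blocks⇒embed (Y⊆ x (∈-elements⁻ Y x∈ys))
        ...   | j , v , refl with i Fin.≟ j
        ...     | yes refl = v , refl
        ...     | no i≢j   = ⊥-elim (subst (T ∘ Vec.head) (project-embed-≢ v i≢j) x∈i)

        project-outside : ∀ i {x} → x ∈ˡ outside i → project i x ≡ 0ᵛ
        project-outside i {x} x∈ with Mem.∈-filter⁻ (¬? ∘ inBlock? i) {xs = ys} x∈
        ... | x∈ys , x∉i with blocks⇒embed (Y⊆ x (∈-elements⁻ Y x∈ys))
        ...   | j , v , refl with i Fin.≟ j
        ...     | yes refl = contradiction (embed-InBlock i v) x∉i
        ...     | no i≢j   = project-embed-≢ v i≢j

        inside-determined : ∀ i {x y} → x ∈ˡ inside i → y ∈ˡ inside i →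
          project i x ≡ project i y → x ≡ y
        inside-determined i x∈ y∈ eq with inside⇒embed i x∈ | inside⇒embed i y∈
        ... | v , refl | w , refl = cong (embed i) (Vec.∷-injectiveʳ
          (trans (sym (project-embed i v)) (trans eq (project-embed i w))))

        inside-unique : ∀ i → Unique (inside i)
        inside-unique i = Unique.filter⁺ (inBlock? i) (elements-unique Y)

        outside-unique : ∀ i → Unique (outside i)
        outside-unique i = Unique.filter⁺ (¬? ∘ inBlock? i) (elements-unique Y)

        inside-small : ∀ i → length (inside i) ℕ.≤ q
        inside-small i = subst (length (inside i) ℕ.≤_) (length-vectors m)
          (length-injection (Vec.tail ∘ project i) (inside-unique i) (λ _ → ∈-vectors _) inj)
          where
          inj : ∀ {x y} → x ∈ˡ inside i → y ∈ˡ inside i →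
            Vec.tail (project i x) ≡ Vec.tail (project i y) → x ≡ y
          inj x∈ y∈ eq with inside⇒embed i x∈ | inside⇒embed i y∈
          ... | v , refl | w , refl = cong (embed i)
            (trans (sym (cong Vec.tail (project-embed i v)))
              (trans eq (cong Vec.tail (project-embed i w))))

        -- Since y projects to 0, x + y has the same projection to summand `i` as x. Within the
        -- block this projection determines x, and then y follows by cancellation.
        inside*outside≤sumset : ∀ i → length (inside i) ℕ.* length (outside i) ℕ.≤ card (Y ⊞ Y)
        inside*outside≤sumset i = subst (ℕ._≤ card (Y ⊞ Y))
          (length-cartesianProduct (inside i) (outside i))
          (length-injection (λ (x , y) → x ⊕ y)
            (Unique.cartesianProduct⁺ (inside-unique i) (outside-unique i)) into inj)
          where
          pairs = cartesianProduct (inside i) (outside i)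
          into : ∀ {p} → p ∈ˡ pairs → proj₁ p ⊕ proj₂ p ∈ˡ elements (Y ⊞ Y)
          into {x , y} p∈ with Mem.∈-cartesianProduct⁻ (inside i) (outside i) p∈
          ... | x∈ , y∈ = ∈-elements⁺ (Y ⊞ Y) (∈-⊞⁺ Y Y
            (∈-elements⁻ Y (proj₁ (Mem.∈-filter⁻ (inBlock? i) {xs = ys} x∈)))
            (∈-elements⁻ Y (proj₁ (Mem.∈-filter⁻ (¬? ∘ inBlock? i) {xs = ys} y∈))))
          project-sum : ∀ {x y} → y ∈ˡ outside i → project i (x ⊕ y) ≡ project i x
          project-sum {x} {y} y∈ = trans (project-⊕ i x y)
            (trans (cong (project i x ⊕_) (project-outside i y∈)) (⊕-identityʳ _))
          inj : ∀ {p p′} → p ∈ˡ pairs → p′ ∈ˡ pairs →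
            proj₁ p ⊕ proj₂ p ≡ proj₁ p′ ⊕ proj₂ p′ → p ≡ p′
          inj {x , y} {x′ , y′} p∈ p′∈ eq
            with Mem.∈-cartesianProduct⁻ (inside i) (outside i) p∈
               | Mem.∈-cartesianProduct⁻ (inside i) (outside i) p′∈
          ... | x∈ , y∈ | x′∈ , y′∈
            with inside-determined i x∈ x′∈
                   (trans (sym (project-sum {x} y∈)) (trans (cong (project i) eq) (project-sum {x′} y′∈)))
          ... | refl = cong (x ,_) (⊕-cancelˡ x eq)

      -- The two alternatives end in different bounds, q + 2 ℓ and r (2 ℓ). Adding the error terms
      -- gives one constant, independent of `m`, that serves both.
      small-doubling⇒small : ∀ ℓ → card (Y ⊞ Y) ℕ.≤ ℓ ℕ.* card Y →
        card Y ℕ.≤ q ℕ.+ (2 ℕ.* ℓ ℕ.+ r ℕ.* (2 ℕ.* ℓ))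
      small-doubling⇒small ℓ h with card Y ℕ.≤? q ℕ.+ 2 ℕ.* ℓ
      ... | yes le = ℕ.≤-trans le (ℕ.+-monoʳ-≤ q (ℕ.m≤m+n (2 ℕ.* ℓ) (r ℕ.* (2 ℕ.* ℓ))))
      ... | no ¬le = ℕ.≤-trans
        (subst (λ k → card Y ℕ.≤ k ℕ.* (2 ℕ.* ℓ)) (List.length-tabulate {n = r} id)
          (length-covered inBlock? (allFin r) ys cover small))
        (ℕ.≤-trans (ℕ.m≤n+m (r ℕ.* (2 ℕ.* ℓ)) (2 ℕ.* ℓ)) (ℕ.m≤n+m _ q))
        where
        cover : ∀ {x} → x ∈ˡ ys → ∃ λ i → i ∈ˡ allFin r × InBlock i x
        cover {x} x∈ with blocks⇒embed (Y⊆ x (∈-elements⁻ Y x∈))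
        ... | i , v , refl = i , Mem.∈-allFin i , embed-InBlock i v
        small : ∀ i → length (inside i) ℕ.≤ 2 ℕ.* ℓ
        small i with ℕ.≤-total (length (inside i)) (length (outside i))
        ... | inj₁ in≤out = factor-bound ℓ _ _ in≤out prod≤
          where
          prod≤ : length (inside i) ℕ.* length (outside i) ℕ.≤
                  ℓ ℕ.* (length (inside i) ℕ.+ length (outside i))
          prod≤ = ℕ.≤-trans (inside*outside≤sumset i) (subst (λ k → card (Y ⊞ Y) ℕ.≤ ℓ ℕ.* k)
            (sym (length-filter-split (inBlock? i) ys)) h)
        -- If the outside part were the smaller one, it would have at most 2 ℓ points; with at most
        -- q points in the block, `card Y` could not exceed q + 2 ℓ.
        ... | inj₂ out≤in = contradiction
          (subst (ℕ._≤ q ℕ.+ 2 ℕ.* ℓ) (length-filter-split (inBlock? i) ys)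
            (ℕ.+-mono-≤ (inside-small i) (factor-bound ℓ _ _ out≤in prod≤)))
          ¬le
          where
          prod≤ : length (outside i) ℕ.* length (inside i) ℕ.≤
                  ℓ ℕ.* (length (outside i) ℕ.+ length (inside i))
          prod≤ = subst₂ (λ k l → k ℕ.≤ ℓ ℕ.* l)
            (ℕ.*-comm (length (inside i)) (length (outside i)))
            (trans (sym (length-filter-split (inBlock? i) ys))
              (ℕ.+-comm (length (inside i)) (length (outside i))))
            (ℕ.≤-trans (inside*outside≤sumset i) h)

-- Opaque, as unification would otherwise normalise the fractions.
opaque
  ⟨_⟩ : ℕ → ℚ
  ⟨ m ⟩ = + m ℚ./ 1

  ⟨⟩-mkℚ : ∀ m → ⟨ m ⟩ ≡ ℚ.mkℚ (+ m) 0 (Coprimality.sym (Coprimality.1-coprimeTo m))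
  ⟨⟩-mkℚ m = ℚ.normalize-coprime (Coprimality.sym (Coprimality.1-coprimeTo m))

  ⟨⟩-mono-≤ : ∀ {m n} → m ℕ.≤ n → ⟨ m ⟩ ℚ.≤ ⟨ n ⟩
  ⟨⟩-mono-≤ {m} {n} m≤n = subst₂ ℚ._≤_ (sym (⟨⟩-mkℚ m)) (sym (⟨⟩-mkℚ n))
    (ℚ.*≤* (ℤ.*-monoʳ-≤-nonNeg (+ 1) (ℤ.+≤+ m≤n)))

  ⟨⟩-cancel-≤ : ∀ {m n} → ⟨ m ⟩ ℚ.≤ ⟨ n ⟩ → m ℕ.≤ n
  ⟨⟩-cancel-≤ {m} {n} h with subst₂ ℚ._≤_ (⟨⟩-mkℚ m) (⟨⟩-mkℚ n) h
  ... | ℚ.*≤* h′ = ℤ.drop‿+≤+ (ℤ.*-cancelʳ-≤-pos (+ m) (+ n) (+ 1) h′)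

  ⟨⟩-mono-< : ∀ {m n} → m ℕ.< n → ⟨ m ⟩ ℚ.< ⟨ n ⟩
  ⟨⟩-mono-< {m} {n} m<n = ℚ.≰⇒> λ h → ℕ.<⇒≱ m<n (⟨⟩-cancel-≤ {n} {m} h)

  0≤⟨⟩ : ∀ m → 0ℚ ℚ.≤ ⟨ m ⟩
  0≤⟨⟩ m = ⟨⟩-mono-≤ {0} {m} ℕ.z≤n

  0<⟨⟩ : ∀ {m} → 0 ℕ.< m → 0ℚ ℚ.< ⟨ m ⟩
  0<⟨⟩ {m} = ⟨⟩-mono-< {0} {m}

  ⟨0⟩≡0 : ⟨ 0 ⟩ ≡ 0ℚ
  ⟨0⟩≡0 = refl

  ⟨1⟩≡1 : ⟨ 1 ⟩ ≡ 1ℚ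
  ⟨1⟩≡1 = refl

  ≤-⟨⟩ : ∀ q → ∃ λ ℓ → q ℚ.≤ ⟨ ℓ ⟩
  ≤-⟨⟩ q@(ℚ.mkℚ ℤ.-[1+ _ ] _ _) = 0 , subst (q ℚ.≤_) (sym ⟨0⟩≡0) (ℚ.<⇒≤ (ℚ.negative⁻¹ q))
  ≤-⟨⟩ q@(ℚ.mkℚ (+ a) d _) = a , subst (q ℚ.≤_) (sym (⟨⟩-mkℚ a))
    (ℚ.*≤* (ℤ.*-monoˡ-≤-nonNeg (+ a) {+ 1} {+ suc d} (ℤ.+≤+ (ℕ.s≤s ℕ.z≤n))))

  seq-fromℕ : ∀ m n → seq (fromℕ m) n ≡ ⟨ m ⟩
  seq-fromℕ m n = refl

  ⟨⟩-homo-+ : ∀ m n → ⟨ m ℕ.+ n ⟩ ≡ ⟨ m ⟩ ℚ.+ ⟨ n ⟩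
  ⟨⟩-homo-+ m n rewrite ⟨⟩-mkℚ m | ⟨⟩-mkℚ n =
    cong (ℚ._/ 1) (sym (cong₂ ℤ._+_ (ℤ.*-identityʳ (+ m)) (ℤ.*-identityʳ (+ n))))

  ⟨⟩-homo-* : ∀ m n → ⟨ m ℕ.* n ⟩ ≡ ⟨ m ⟩ ℚ.* ⟨ n ⟩
  ⟨⟩-homo-* m n rewrite ⟨⟩-mkℚ m | ⟨⟩-mkℚ n = cong (ℚ._/ 1) (ℤ.pos-* m n)

  ratioℚ : ℕ → (d : ℕ) → 0 ℕ.< d → ℚ
  ratioℚ m d 0<d = ℚ._/_ (+ m) d {{ℕ.>-nonZero 0<d}}

  ratioℚ-*-cancel : ∀ m d 0<d → ratioℚ m d 0<d ℚ.* ⟨ d ⟩ ≡ ⟨ m ⟩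
  ratioℚ-*-cancel m (suc d) _ = ℚ.toℚᵘ-injective (begin
    ℚ.toℚᵘ (ℚ.fromℚᵘ p ℚ.* ℚ.fromℚᵘ q)          ≈⟨ ℚ.toℚᵘ-homo-* (ℚ.fromℚᵘ p) (ℚ.fromℚᵘ q) ⟩
    ℚ.toℚᵘ (ℚ.fromℚᵘ p) ℚᵘ.* ℚ.toℚᵘ (ℚ.fromℚᵘ q) ≈⟨ ℚᵘ.*-cong (ℚ.toℚᵘ-fromℚᵘ p) (ℚ.toℚᵘ-fromℚᵘ q) ⟩
    p ℚᵘ.* q                                      ≈⟨ ℚᵘ.*≡* (ℤ.*-assoc (+ m) (+ suc d) (+ 1)) ⟩
    ℚᵘ.mkℚᵘ (+ m) 0                               ≈⟨ ℚᵘ.≃-sym (ℚ.toℚᵘ-fromℚᵘ (ℚᵘ.mkℚᵘ (+ m) 0)) ⟩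
    ℚ.toℚᵘ (ℚ.fromℚᵘ (ℚᵘ.mkℚᵘ (+ m) 0))          ∎)
    where
    open ℚᵘ.≃-Reasoning
    p q : ℚᵘ.ℚᵘ
    p = ℚᵘ.mkℚᵘ (+ m) d
    q = ℚᵘ.mkℚᵘ (+ suc d) 0

  seq-ratio : ∀ m d 0<d n → seq (ratio m d 0<d) n ≡ ratioℚ m d 0<d
  seq-ratio m d 0<d n = refl

-- Order and arithmetic of real sequences

Seq : Set
Seq = ℕ → ℚ

private
  variable
    s t u v : Seq

*-monoˡ-≤ᵠ : ∀ {r p q} → 0ℚ ℚ.≤ r → p ℚ.≤ q → r ℚ.* p ℚ.≤ r ℚ.* q
*-monoˡ-≤ᵠ {r} 0≤r = ℚ.*-monoˡ-≤-nonNeg r {{ℚ.nonNegative 0≤r}}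

*-cancelʳ-≤ᵠ : ∀ {r p q} → 0ℚ ℚ.< r → p ℚ.* r ℚ.≤ q ℚ.* r → p ℚ.≤ q
*-cancelʳ-≤ᵠ {r} 0<r = ℚ.*-cancelʳ-≤-pos r {{ℚ.positive 0<r}}

*-pos : ∀ {p q} → 0ℚ ℚ.< p → 0ℚ ℚ.< q → 0ℚ ℚ.< p ℚ.* q
*-pos {p} {q} 0<p 0<q =
  ℚ.positive⁻¹ _ {{ℚ.pos*pos⇒pos p {{ℚ.positive 0<p}} q {{ℚ.positive 0<q}}}}

0<½ : 0ℚ ℚ.< ½
0<½ = ℚ.positive⁻¹ ½

0<1 : 0ℚ ℚ.< 1ℚ
0<1 = ℚ.positive⁻¹ 1ℚ

half+half : ∀ ε → ½ ℚ.* ε ℚ.+ ½ ℚ.* ε ≡ ε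
half+half ε = trans (sym (ℚ.*-distribʳ-+ ε ½ ½)) (ℚ.*-identityˡ ε)

halves : ∀ p ε → p ℚ.+ ½ ℚ.* ε ℚ.+ ½ ℚ.* ε ≡ p ℚ.+ ε
halves p ε = trans (ℚ.+-assoc p (½ ℚ.* ε) (½ ℚ.* ε)) (cong (p ℚ.+_) (half+half ε))

∣p-q∣≤ε⇒p≤q+ε : ∀ {p q ε} → ∣ p ℚ.- q ∣ ℚ.≤ ε → p ℚ.≤ q ℚ.+ ε
∣p-q∣≤ε⇒p≤q+ε {p} {q} {ε} h = begin
  p                    ≡⟨ cancel p q ⟩
  q ℚ.+ (p ℚ.- q)      ≤⟨ ℚ.+-monoʳ-≤ q (ℚ.≤-trans (p≤∣p∣ (p ℚ.- q)) h) ⟩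
  q ℚ.+ ε              ∎
  where
  open ℚ.≤-Reasoning
  p≤∣p∣ : ∀ p → p ℚ.≤ ∣ p ∣
  p≤∣p∣ p with ℚ.≤-total 0ℚ p
  ... | inj₁ 0≤p = ℚ.≤-reflexive (sym (ℚ.0≤p⇒∣p∣≡p 0≤p))
  ... | inj₂ p≤0 = ℚ.≤-trans p≤0 (ℚ.0≤∣p∣ p)
  cancel : ∀ p q → p ≡ q ℚ.+ (p ℚ.- q)
  cancel = solve 2 (λ p q → p := q :+ (p :- q)) refl
    where open ℚSolver

p<p+ε : ∀ p {ε} → 0ℚ ℚ.< ε → p ℚ.< p ℚ.+ ε
p<p+ε p {ε} 0<ε = subst (ℚ._< p ℚ.+ ε) (ℚ.+-identityʳ p) (ℚ.+-monoʳ-< p 0<ε)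

p≤p+ε : ∀ p {ε} → 0ℚ ℚ.< ε → p ℚ.≤ p ℚ.+ ε
p≤p+ε p 0<ε = ℚ.<⇒≤ (p<p+ε p 0<ε)

shrink : ∀ b ε → 0ℚ ℚ.< b → 0ℚ ℚ.< ε → ∃ λ δ → 0ℚ ℚ.< δ × δ ℚ.* b ≡ ε
shrink b ε 0<b 0<ε = ε ℚ.* b⁻¹ , *-pos 0<ε 0<b⁻¹ , (begin
  ε ℚ.* b⁻¹ ℚ.* b     ≡⟨ ℚ.*-assoc ε b⁻¹ b ⟩
  ε ℚ.* (b⁻¹ ℚ.* b)   ≡⟨ cong (ε ℚ.*_) (ℚ.*-inverseˡ b {{nz}}) ⟩
  ε ℚ.* 1ℚ            ≡⟨ ℚ.*-identityʳ ε ⟩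
  ε                   ∎)
  where
  open ≡-Reasoning
  nz = ℚ.>-nonZero 0<b
  b⁻¹ = ℚ.1/_ b {{nz}}
  0<b⁻¹ : 0ℚ ℚ.< b⁻¹
  0<b⁻¹ = ℚ.positive⁻¹ b⁻¹ {{ℚ.1/pos⇒pos b {{ℚ.positive 0<b}}}}

-- Orders and identities of reals are proved for the underlying sequences: _≼_ is
-- _≤_, and _≋_ is eventual equality, wrapped in records so that the two sides
-- can be inferred from a proof.
record _≼_ (s t : Seq) : Set where
  constructor ⌜_⌝
  field ⌞_⌟ : ∀ ε → 0ℚ ℚ.< ε → ∃ λ N → ∀ n → N ℕ.≤ n → s n ℚ.≤ t n ℚ.+ ε
open _≼_

record _≋_ (s t : Seq) : Set where
  constructor eventually
  field
    start : ℕ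
    equal : ∀ n → start ℕ.≤ n → s n ≡ t n

infix  4 _≼_ _≋_
infixl 6 _⊹_
infixl 7 _⊗_

_⊹_ _⊗_ : Seq → Seq → Seq
(s ⊹ t) n = s n ℚ.+ t n
(s ⊗ t) n = s n ℚ.* t n

const : ℚ → Seq
const q _ = q

pointwise : (∀ n → s n ≡ t n) → s ≋ t
pointwise eq = eventually 0 λ n _ → eq n

≋-refl : s ≋ s
≋-refl = pointwise λ _ → refl

≋-sym : s ≋ t → t ≋ s
≋-sym (eventually N eq) = eventually N λ n h → sym (eq n h)

≋-trans : s ≋ t → t ≋ u → s ≋ u
≋-trans (eventually M p) (eventually N q) = eventually (M ℕ.⊔ N) λ n h →
  trans (p n (ℕ.m⊔n≤o⇒m≤o M N h)) (q n (ℕ.m⊔n≤o⇒n≤o M N h))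

⊗-congˡ : ∀ u → s ≋ t → u ⊗ s ≋ u ⊗ t
⊗-congˡ u (eventually N p) = eventually N λ n h → cong (u n ℚ.*_) (p n h)

⊗-comm : ∀ s t → s ⊗ t ≋ t ⊗ s
⊗-comm s t = pointwise λ n → ℚ.*-comm (s n) (t n)

≼-reflexive : s ≋ t → s ≼ t
≼-reflexive {s} {t} (eventually N eq) = ⌜ (λ ε 0<ε → N , λ n h →
  subst (ℚ._≤ t n ℚ.+ ε) (sym (eq n h)) (p≤p+ε (t n) 0<ε)) ⌝

≼-refl : s ≼ s
≼-refl = ≼-reflexive ≋-refl

≼-trans : s ≼ t → t ≼ u → s ≼ u
≼-trans {s} {t} {u} ⌜ p ⌝ ⌜ q ⌝ = ⌜ (λ ε 0<ε →
  let M , p′ = p (½ ℚ.* ε) (*-pos 0<½ 0<ε)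
      N , q′ = q (½ ℚ.* ε) (*-pos 0<½ 0<ε)
  in M ℕ.⊔ N , λ n h → ℚ.≤-trans (p′ n (ℕ.m⊔n≤o⇒m≤o M N h))
       (subst (t n ℚ.+ ½ ℚ.* ε ℚ.≤_) (halves (u n) ε)
         (ℚ.+-monoˡ-≤ (½ ℚ.* ε) (q′ n (ℕ.m⊔n≤o⇒n≤o M N h))))) ⌝

≼-preorder : Preorder 0ℓ 0ℓ 0ℓ
≼-preorder = record
  { _≈_ = _≋_
  ; _≲_ = _≼_
  ; isPreorder = record
    { isEquivalence = record { refl = ≋-refl ; sym = ≋-sym ; trans = ≋-trans }
    ; reflexive = ≼-reflexive
    ; trans = ≼-trans
    }
  }

module ≼-Reasoning = Relation.Binary.Reasoning.Preorder ≼-preorder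

const-mono : ∀ {p q} → p ℚ.≤ q → const p ≼ const q
const-mono {q = q} p≤q = ⌜ (λ ε 0<ε → 0 , λ _ _ → ℚ.≤-trans p≤q (p≤p+ε q 0<ε)) ⌝

const-cancel : ∀ {p q} → const p ≼ const q → p ℚ.≤ q
const-cancel {p} {q} ⌜ p≤q ⌝ = ℚ.≮⇒≥ λ q<p →
  let c , q<c , c<p = ℚ.<-dense q<p
      0<c-q = subst (ℚ._< c ℚ.- q) (ℚ.+-inverseʳ q) (ℚ.+-monoˡ-< (ℚ.- q) q<c)
      N , h = p≤q (c ℚ.- q) 0<c-q
  in ℚ.<-irrefl refl (ℚ.<-≤-trans c<p (subst (p ℚ.≤_) (cancel c q) (h N ℕ.≤-refl)))
  where
  cancel : ∀ c q → q ℚ.+ (c ℚ.- q) ≡ c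
  cancel = solve 2 (λ c q → q :+ (c :- q) := c) refl
    where open ℚSolver

⊹-mono : s ≼ t → u ≼ v → s ⊹ u ≼ t ⊹ v
⊹-mono {s} {t} {u} {v} ⌜ p ⌝ ⌜ q ⌝ = ⌜ (λ ε 0<ε →
  let M , p′ = p (½ ℚ.* ε) (*-pos 0<½ 0<ε)
      N , q′ = q (½ ℚ.* ε) (*-pos 0<½ 0<ε)
  in M ℕ.⊔ N , λ n h → subst (s n ℚ.+ u n ℚ.≤_) (rearrange (t n) (v n) ε)
       (ℚ.+-mono-≤ (p′ n (ℕ.m⊔n≤o⇒m≤o M N h)) (q′ n (ℕ.m⊔n≤o⇒n≤o M N h)))) ⌝
  where
  rearrange : ∀ a b ε → (a ℚ.+ ½ ℚ.* ε) ℚ.+ (b ℚ.+ ½ ℚ.* ε) ≡ (a ℚ.+ b) ℚ.+ ε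
  rearrange = solve 3 (λ a b ε →
    (a :+ con ½ :* ε) :+ (b :+ con ½ :* ε) := (a :+ b) :+ ε) refl
    where open ℚSolver

-- Since s ≼ t holds only up to each ε, a factor must be bounded as well as nonnegative to preserve
-- it: the tolerance is divided by the bound.
record Multiplier (s : Seq) : Set where
  constructor multiplier
  field
    bound start : ℕ
    0≤  : ∀ n → start ℕ.≤ n → 0ℚ ℚ.≤ s n
    ≤bound : ∀ n → start ℕ.≤ n → s n ℚ.≤ ⟨ bound ⟩

upper-bound : ∀ x → ∃ λ ℓ → ∃ λ N → ∀ n → N ℕ.≤ n → seq x n ℚ.≤ ⟨ ℓ ⟩
upper-bound x =
  let N , c = cauchy x 1ℚ 0<1
      ℓ , h = ≤-⟨⟩ (seq x N ℚ.+ 1ℚ)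
  in ℓ , N , λ n N≤n → ℚ.≤-trans (∣p-q∣≤ε⇒p≤q+ε {seq x n} (c n N N≤n ℕ.≤-refl)) h

≼-fromℕ : ∀ x → ∃ λ ℓ → seq x ≼ const ⟨ ℓ ⟩
≼-fromℕ x = let ℓ , N , h = upper-bound x in
  ℓ , ⌜ (λ ε 0<ε → N , λ n N≤n → ℚ.≤-trans (h n N≤n) (p≤p+ε ⟨ ℓ ⟩ 0<ε)) ⌝

eventually-nonNeg⇒multiplier : ∀ x N → (∀ n → N ℕ.≤ n → 0ℚ ℚ.≤ seq x n) → Multiplier (seq x)
eventually-nonNeg⇒multiplier x M 0≤x = let ℓ , N , h = upper-bound x in
  multiplier ℓ (M ℕ.⊔ N) (λ n hn → 0≤x n (ℕ.m⊔n≤o⇒m≤o M N hn)) (λ n hn → h n (ℕ.m⊔n≤o⇒n≤o M N hn))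

const-multiplier : ∀ {q} → 0ℚ ℚ.≤ q → Multiplier (const q)
const-multiplier {q} 0≤q = eventually-nonNeg⇒multiplier (fromℚ q) 0 λ _ _ → 0≤q

⟨⟩-multiplier : ∀ m → Multiplier (const ⟨ m ⟩)
⟨⟩-multiplier m = const-multiplier (0≤⟨⟩ m)

⊗-monoˡ : Multiplier u → s ≼ t → u ⊗ s ≼ u ⊗ t
⊗-monoˡ {u} {s} {t} (multiplier ℓ M 0≤u u≤ℓ) ⌜ s≤t ⌝ = ⌜ (λ ε 0<ε →
  -- `suc ℓ` instead of `ℓ`, as the bound itself may be 0.
  let δ , 0<δ , δ*≡ε = shrink ⟨ suc ℓ ⟩ ε (0<⟨⟩ {suc ℓ} ℕ.z<s) 0<ε
      N , h = s≤t δ 0<δ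
  in M ℕ.⊔ N , λ n hn →
    let hM = ℕ.m⊔n≤o⇒m≤o M N hn
    in bound (u n) (s n) (t n) (0≤u n hM)
         (ℚ.≤-trans (u≤ℓ n hM) (⟨⟩-mono-≤ (ℕ.n≤1+n ℓ))) 0<δ δ*≡ε
         (h n (ℕ.m⊔n≤o⇒n≤o M N hn))) ⌝
  where
  bound : ∀ a b c {d δ ε} → 0ℚ ℚ.≤ a → a ℚ.≤ d → 0ℚ ℚ.< δ → δ ℚ.* d ≡ ε →
    b ℚ.≤ c ℚ.+ δ → a ℚ.* b ℚ.≤ a ℚ.* c ℚ.+ ε
  bound a b c {d} {δ} {ε} 0≤a a≤d 0<δ eq b≤ = begin
    a ℚ.* b                  ≤⟨ *-monoˡ-≤ᵠ 0≤a b≤ ⟩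
    a ℚ.* (c ℚ.+ δ)          ≡⟨ ℚ.*-distribˡ-+ a c δ ⟩
    a ℚ.* c ℚ.+ a ℚ.* δ      ≡⟨ cong (a ℚ.* c ℚ.+_) (ℚ.*-comm a δ) ⟩
    a ℚ.* c ℚ.+ δ ℚ.* a      ≤⟨ ℚ.+-monoʳ-≤ (a ℚ.* c) (*-monoˡ-≤ᵠ (ℚ.<⇒≤ 0<δ) a≤d) ⟩
    a ℚ.* c ℚ.+ δ ℚ.* d      ≡⟨ cong (a ℚ.* c ℚ.+_) eq ⟩
    a ℚ.* c ℚ.+ ε            ∎
    where open ℚ.≤-Reasoning

⊗-monoʳ : Multiplier u → s ≼ t → s ⊗ u ≼ t ⊗ u
⊗-monoʳ {u} {s} {t} 0≤u s≼t = begin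
  s ⊗ u   ≈⟨ ⊗-comm s u ⟩
  u ⊗ s   ≲⟨ ⊗-monoˡ 0≤u s≼t ⟩
  u ⊗ t   ≈⟨ ⊗-comm u t ⟩
  t ⊗ u   ∎
  where open ≼-Reasoning

recip-multiplier : ∀ x (0<x : 0ℝ < x) → Multiplier (seq (recip x 0<x))
recip-multiplier x 0<x@(ε , 0<ε , _) = eventually-nonNeg⇒multiplier (recip x 0<x) 0 λ n _ →
  ℚ.<⇒≤ (ℚ.positive⁻¹ _ {{ℚ.1/pos⇒pos (seq x n ℚ.⊔ ε)
    {{ℚ.positive (ℚ.<-≤-trans 0<ε (ℚ.p≤q⊔p (seq x n) ε))}}}})

-- `recip` inverts max(x, ε), which agrees with x only from some index on. This is why equality of
-- sequences is taken to be eventual.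
*-recip : ∀ x (0<x : 0ℝ < x) → seq x ⊗ seq (recip x 0<x) ≋ const 1ℚ
*-recip x (ε , 0<ε , N , h) = eventually N λ n N≤n → trans
  (cong (ℚ._* inv n) (sym (ℚ.p≥q⇒p⊔q≡p (subst (ℚ._≤ seq x n) (ℚ.+-identityˡ ε) (h n N≤n)))))
  (ℚ.*-inverseʳ (seq x n ℚ.⊔ ε) {{nz n}})
  where
  nz : ∀ n → ℚ.NonZero (seq x n ℚ.⊔ ε)
  nz n = ℚ.>-nonZero (ℚ.<-≤-trans 0<ε (ℚ.p≤q⊔p (seq x n) ε))
  inv : ℕ → ℚ
  inv n = ℚ.1/_ (seq x n ℚ.⊔ ε) {{nz n}}

recip-*-cancel : ∀ x (0<x : 0ℝ < x) s → seq (recip x 0<x) ⊗ (seq x ⊗ s) ≋ s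
recip-*-cancel x 0<x s = ≋-trans
  (pointwise λ n → rearrange (seq (recip x 0<x) n) (seq x n) (s n))
  (≋-trans (⊗-congˡ s (*-recip x 0<x)) (pointwise λ n → ℚ.*-identityʳ (s n)))
  where
  rearrange : ∀ i a b → i ℚ.* (a ℚ.* b) ≡ b ℚ.* (a ℚ.* i)
  rearrange = solve 3 (λ i a b → i :* (a :* b) := b :* (a :* i)) refl
    where open ℚSolver

⊗-cancelˡ : ∀ x → 0ℝ < x → seq x ⊗ s ≼ seq x ⊗ t → s ≼ t
⊗-cancelˡ {s} {t} x 0<x xs≼xt = begin
  s                                  ≈⟨ ≋-sym (recip-*-cancel x 0<x s) ⟩
  seq (recip x 0<x) ⊗ (seq x ⊗ s)    ≲⟨ ⊗-monoˡ (recip-multiplier x 0<x) xs≼xt ⟩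
  seq (recip x 0<x) ⊗ (seq x ⊗ t)    ≈⟨ recip-*-cancel x 0<x t ⟩
  t                                  ∎
  where open ≼-Reasoning

recip-unique : ∀ x (0<x : 0ℝ < x) y → seq x ⊗ seq y ≼ const 1ℚ → const 1ℚ ≼ seq x ⊗ seq y →
  y ≃ recip x 0<x
recip-unique x 0<x y xy≼1 1≼xy =
    ⌞ ⊗-cancelˡ x 0<x (≼-trans xy≼1 (≼-reflexive (≋-sym (*-recip x 0<x)))) ⌟
  , ⌞ ⊗-cancelˡ x 0<x (≼-trans (≼-reflexive (*-recip x 0<x)) 1≼xy) ⌟

-- Limits along powers of 2 and rational approximation of reals

n<2^n : ∀ n → n ℕ.< 2 ℕ.^ n
n<2^n zero    = ℕ.z<s
n<2^n (suc n) = ℕ.+-mono-≤ (ℕ.≤-trans (ℕ.s≤s ℕ.z≤n) (n<2^n n)) (ℕ.≤-trans (n<2^n n) (ℕ.m≤m+n _ 0))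

-- With D ≥ 1/ε and m = C D one has C ≤ ε m ≤ ε 2^m. Powers of 2 are asked for because they are the
-- sizes of cosets and of whole spaces.
archimedean : ∀ ε → 0ℚ ℚ.< ε → ∀ C → ∃ λ m → ⟨ C ⟩ ℚ.≤ ε ℚ.* ⟨ 2 ℕ.^ m ⟩
archimedean ε 0<ε C =
  let δ , 0<δ , δε≡1 = shrink ε 1ℚ 0<ε 0<1
      D , δ≤D = ≤-⟨⟩ δ
      m = C ℕ.* D
      1≤εD : 1ℚ ℚ.≤ ε ℚ.* ⟨ D ⟩
      1≤εD = subst (ℚ._≤ ε ℚ.* ⟨ D ⟩) (trans (ℚ.*-comm ε δ) δε≡1) (*-monoˡ-≤ᵠ (ℚ.<⇒≤ 0<ε) δ≤D)
  in m , (begin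
    ⟨ C ⟩                         ≡⟨ sym (ℚ.*-identityʳ ⟨ C ⟩) ⟩
    ⟨ C ⟩ ℚ.* 1ℚ                  ≤⟨ *-monoˡ-≤ᵠ (0≤⟨⟩ C) 1≤εD ⟩
    ⟨ C ⟩ ℚ.* (ε ℚ.* ⟨ D ⟩)       ≡⟨ rearrange ⟨ C ⟩ ε ⟨ D ⟩ ⟩
    ε ℚ.* (⟨ C ⟩ ℚ.* ⟨ D ⟩)       ≡⟨ cong (ε ℚ.*_) (sym (⟨⟩-homo-* C D)) ⟩
    ε ℚ.* ⟨ m ⟩                   ≤⟨ *-monoˡ-≤ᵠ (ℚ.<⇒≤ 0<ε) (⟨⟩-mono-≤ (ℕ.<⇒≤ (n<2^n m))) ⟩
    ε ℚ.* ⟨ 2 ℕ.^ m ⟩             ∎)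
  where
  open ℚ.≤-Reasoning
  rearrange : ∀ c e d → c ℚ.* (e ℚ.* d) ≡ e ℚ.* (c ℚ.* d)
  rearrange = solve 3 (λ c e d → c :* (e :* d) := e :* (c :* d)) refl
    where open ℚSolver

≼-1/r : ∀ x r (0<r : 0 ℕ.< r) C →
  (∀ m → seq x ⊗ const ⟨ r ℕ.* 2 ℕ.^ m ⟩ ≼ const ⟨ 2 ℕ.^ m ℕ.+ C ⟩) →
  seq x ≼ const (ratioℚ 1 r 0<r)
≼-1/r x r 0<r C h = ⌜ (λ ε 0<ε →
  let 0<⟨r⟩ = 0<⟨⟩ 0<r
      -- After division by r 2^m the error is (C + 1) / (r 2^m), to be made at most ε. The 1 added
      -- to `C` pays for the tolerance `⟨ 1 ⟩` at which `h m` is used.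
      m , C+1≤ = archimedean (ε ℚ.* ⟨ r ⟩) (*-pos 0<ε 0<⟨r⟩) (C ℕ.+ 1)
      q = 2 ℕ.^ m
      N , hₙ = ⌞ h m ⌟ ⟨ 1 ⟩ (0<⟨⟩ ℕ.z<s)
      0<⟨rq⟩ = 0<⟨⟩ {r ℕ.* q} (ℕ.*-mono-≤ 0<r (ℕ.m^n>0 2 m))
  in N , λ n N≤n → *-cancelʳ-≤ᵠ 0<⟨rq⟩ (begin
    seq x n ℚ.* ⟨ r ℕ.* q ⟩
      ≤⟨ hₙ n N≤n ⟩
    ⟨ q ℕ.+ C ⟩ ℚ.+ ⟨ 1 ⟩
      ≡⟨ sym (⟨⟩-homo-+ (q ℕ.+ C) 1) ⟩
    ⟨ q ℕ.+ C ℕ.+ 1 ⟩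
      ≡⟨ cong ⟨_⟩ (ℕ.+-assoc q C 1) ⟩
    ⟨ q ℕ.+ (C ℕ.+ 1) ⟩
      ≡⟨ ⟨⟩-homo-+ q (C ℕ.+ 1) ⟩
    ⟨ q ⟩ ℚ.+ ⟨ C ℕ.+ 1 ⟩
      ≤⟨ ℚ.+-monoʳ-≤ ⟨ q ⟩ C+1≤ ⟩
    ⟨ q ⟩ ℚ.+ ε ℚ.* ⟨ r ⟩ ℚ.* ⟨ q ⟩
      ≡⟨ cong (ℚ._+ ε ℚ.* ⟨ r ⟩ ℚ.* ⟨ q ⟩)
           (trans (sym (ℚ.*-identityˡ ⟨ q ⟩)) (cong (ℚ._* ⟨ q ⟩) (sym (trans (ratioℚ-*-cancel 1 r 0<r) ⟨1⟩≡1)))) ⟩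
    ratioℚ 1 r 0<r ℚ.* ⟨ r ⟩ ℚ.* ⟨ q ⟩ ℚ.+ ε ℚ.* ⟨ r ⟩ ℚ.* ⟨ q ⟩
      ≡⟨ rearrange (ratioℚ 1 r 0<r) ε ⟨ r ⟩ ⟨ q ⟩ ⟩
    (ratioℚ 1 r 0<r ℚ.+ ε) ℚ.* (⟨ r ⟩ ℚ.* ⟨ q ⟩)
      ≡⟨ cong ((ratioℚ 1 r 0<r ℚ.+ ε) ℚ.*_) (sym (⟨⟩-homo-* r q)) ⟩
    (ratioℚ 1 r 0<r ℚ.+ ε) ℚ.* ⟨ r ℕ.* q ⟩ ∎)) ⌝
  where
  open ℚ.≤-Reasoning
  rearrange : ∀ w e r q → w ℚ.* r ℚ.* q ℚ.+ e ℚ.* r ℚ.* q ≡ (w ℚ.+ e) ℚ.* (r ℚ.* q)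
  rearrange = solve 4 (λ w e r q → w :* r :* q :+ e :* r :* q := (w :+ e) :* (r :* q)) refl
    where open ℚSolver

-- Constructively a real cannot be compared with a single rational. Against two, it is enough to
-- compare one term of the sequence, accurate to (b - a)/2, with their midpoint.
locate : ∀ x {a b} → a ℚ.< b → const a ≼ seq x ⊎ seq x ≼ const b
locate x {a} {b} a<b with cauchy x (½ ℚ.* (b ℚ.- a)) (*-pos 0<½ 0<b-a)
  where
  0<b-a : 0ℚ ℚ.< b ℚ.- a
  0<b-a = subst (ℚ._< b ℚ.- a) (ℚ.+-inverseʳ a) (ℚ.+-monoˡ-< (ℚ.- a) a<b)
... | N , c with ℚ.≤-total (½ ℚ.* (a ℚ.+ b)) (seq x N)
...   | inj₁ mid≤ = inj₁ ⌜ (λ ε 0<ε → N , λ n N≤n → ℚ.≤-trans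
        (subst₂ ℚ._≤_ (lower a b) (upper (seq x n) (½ ℚ.* (b ℚ.- a)))
          (ℚ.+-monoˡ-≤ (ℚ.- (½ ℚ.* (b ℚ.- a)))
            (ℚ.≤-trans mid≤ (∣p-q∣≤ε⇒p≤q+ε {seq x N} (c N n ℕ.≤-refl N≤n)))))
        (p≤p+ε (seq x n) 0<ε)) ⌝
  where
  lower : ∀ a b → ½ ℚ.* (a ℚ.+ b) ℚ.- ½ ℚ.* (b ℚ.- a) ≡ a
  lower = solve 2 (λ a b → con ½ :* (a :+ b) :- con ½ :* (b :- a) := a) refl
    where open ℚSolver
  upper : ∀ c h → c ℚ.+ h ℚ.- h ≡ c
  upper = solve 2 (λ c h → c :+ h :- h := c) refl
    where open ℚSolver
...   | inj₂ ≤mid = inj₂ ⌜ (λ ε 0<ε → N , λ n N≤n → ℚ.≤-trans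
        (ℚ.≤-trans (∣p-q∣≤ε⇒p≤q+ε {seq x n} (c n N N≤n ℕ.≤-refl))
          (subst (seq x N ℚ.+ ½ ℚ.* (b ℚ.- a) ℚ.≤_) (mid+half a b)
            (ℚ.+-monoˡ-≤ (½ ℚ.* (b ℚ.- a)) ≤mid)))
        (p≤p+ε b 0<ε)) ⌝
  where
  mid+half : ∀ a b → ½ ℚ.* (a ℚ.+ b) ℚ.+ ½ ℚ.* (b ℚ.- a) ≡ b
  mid+half = solve 2 (λ a b → con ½ :* (a :+ b) :+ con ½ :* (b :- a) := b) refl
    where open ℚSolver

-- For each ε, apply `locate` between q + ε/2 and q + ε: x ≥ q + ε/2 would refute x ≤ q, against the
-- double negation. This admits a maximum that exists only up to double negation.
≼-const-stable : ∀ x q → ¬ ¬ (seq x ≼ const q) → seq x ≼ const q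
≼-const-stable x q ¬¬x≼q = ⌜ (λ ε 0<ε →
  let 0<½ε = *-pos 0<½ 0<ε
      N , h = ⌞ x≼q+ (½ ℚ.* ε) 0<½ε ⌟ (½ ℚ.* ε) 0<½ε
  in N , λ n N≤n → subst (seq x n ℚ.≤_) (halves q ε) (h n N≤n)) ⌝
  where
  x≼q+ : ∀ ε → 0ℚ ℚ.< ε → seq x ≼ const (q ℚ.+ ε)
  x≼q+ ε 0<ε = [ (λ ≼x → contradiction (λ x≼q → ℚ.<-irrefl refl
                    (ℚ.<-≤-trans (p<p+ε q (*-pos 0<½ 0<ε)) (const-cancel (≼-trans ≼x x≼q)))) ¬¬x≼q) , id ]′
    (locate x (ℚ.+-monoʳ-< q ½ε<ε))
    where
    ½ε<ε : ½ ℚ.* ε ℚ.< ε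
    ½ε<ε = subst (½ ℚ.* ε ℚ.<_) (half+half ε) (p<p+ε (½ ℚ.* ε) (*-pos 0<½ 0<ε))

-- A ceiling with slack 2. Given x ≤ k + 2, `locate` between k and k + 1 either finds k ≤ x, so that
-- y = k + 2 will do, or lowers the upper bound to k + 1.
nat-approx : ∀ x Q → const ⟨ 0 ⟩ ≼ seq x → seq x ≼ const ⟨ Q ⟩ →
  ∃ λ y → y ℕ.≤ Q × seq x ≼ const ⟨ y ⟩ × const ⟨ y ℕ.∸ 2 ⟩ ≼ seq x
nat-approx x zero          0≤x x≤Q = 0 , ℕ.≤-refl , x≤Q , 0≤x
nat-approx x (suc zero)    0≤x x≤Q = 1 , ℕ.≤-refl , x≤Q , 0≤x
nat-approx x (suc (suc Q)) 0≤x x≤Q =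
  [ (λ Q≤x → suc (suc Q) , ℕ.≤-refl , x≤Q , Q≤x)
  , (λ x≤1+Q → let y , y≤ , bounds = nat-approx x (suc Q) 0≤x x≤1+Q in
      y , ℕ.m≤n⇒m≤1+n y≤ , bounds)
  ]′ (locate x (⟨⟩-mono-< (ℕ.n<1+n Q)))

⊖_ : Seq → Seq
(⊖ s) n = ℚ.- s n

infix 8 ⊖_

⊖-anti : s ≼ t → ⊖ t ≼ ⊖ s
⊖-anti {s} {t} s≼t = begin
  ⊖ t                  ≈⟨ pointwise (λ n → left (s n) (t n)) ⟩
  s ⊹ (⊖ s ⊹ ⊖ t)      ≲⟨ ⊹-mono s≼t ≼-refl ⟩
  t ⊹ (⊖ s ⊹ ⊖ t)      ≈⟨ pointwise (λ n → right (s n) (t n)) ⟩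
  ⊖ s                  ∎
  where
  open ≼-Reasoning
  open ℚSolver
  left : ∀ a b → ℚ.- b ≡ a ℚ.+ (ℚ.- a ℚ.+ ℚ.- b)
  left = solve 2 (λ a b → :- b := a :+ (:- a :+ :- b)) refl
  right : ∀ a b → b ℚ.+ (ℚ.- a ℚ.+ ℚ.- b) ≡ ℚ.- a
  right = solve 2 (λ a b → b :+ (:- a :+ :- b) := :- a) refl

fromℕ≋ : ∀ m → seq (fromℕ m) ≋ const ⟨ m ⟩
fromℕ≋ m = pointwise (seq-fromℕ m)

ratio≋ : ∀ m d 0<d → seq (ratio m d 0<d) ≋ const (ratioℚ m d 0<d)
ratio≋ m d 0<d = pointwise (seq-ratio m d 0<d)

*-fromℕ≋ : ∀ s m → s ⊗ seq (fromℕ m) ≋ s ⊗ const ⟨ m ⟩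
*-fromℕ≋ s m = ⊗-congˡ s (fromℕ≋ m)

⟨⟩-⊗ : ∀ m n → const ⟨ m ⟩ ⊗ const ⟨ n ⟩ ≋ const ⟨ m ℕ.* n ⟩
⟨⟩-⊗ m n = pointwise λ _ → sym (⟨⟩-homo-* m n)

⟨⟩-≼ : ∀ {m n} → m ℕ.≤ n → const ⟨ m ⟩ ≼ const ⟨ n ⟩
⟨⟩-≼ m≤n = const-mono (⟨⟩-mono-≤ m≤n)

pos-const : ∀ x {q} → 0ℚ ℚ.< q → const q ≼ seq x → 0ℝ < x
pos-const x {q} 0<q q≼x = ½ ℚ.* q , *-pos 0<½ 0<q ,
  (let N , h = ⌞ q≼x ⌟ (½ ℚ.* q) (*-pos 0<½ 0<q)
   in N , λ n N≤n → subst₂ ℚ._≤_ (left q) (right (seq x n) q)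
        (ℚ.+-monoˡ-≤ (ℚ.- (½ ℚ.* q)) (h n N≤n)))
  where
  open ℚSolver
  left : ∀ q → q ℚ.- ½ ℚ.* q ≡ 0ℚ ℚ.+ ½ ℚ.* q
  left = solve 1 (λ q → q :- con ½ :* q := con 0ℚ :+ con ½ :* q) refl
  right : ∀ a q → a ℚ.+ ½ ℚ.* q ℚ.- ½ ℚ.* q ≡ a
  right = solve 2 (λ a q → a :+ con ½ :* q :- con ½ :* q := a) refl

-- Square roots and reciprocals of integers

module _ (x : ℝ) (0<x : 0ℝ < x) (r : ℕ) where

  private
    z : ℝ
    z = x + fromℕ r

    0<z : 0ℝ < z
    0<z = let ε , 0<ε , N , h = 0<x in ε , 0<ε , N , λ n N≤n →
      subst₂ ℚ._≤_ (ℚ.+-identityʳ (0ℚ ℚ.+ ε)) (cong (seq x n ℚ.+_) (sym (seq-fromℕ r n)))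
        (ℚ.+-mono-≤ (h n N≤n) (0≤⟨⟩ r))

    z*x : seq z ⊗ seq x ≋ seq x ⊗ seq x ⊹ const ⟨ r ⟩ ⊗ seq x
    z*x = pointwise λ n → trans (cong (λ c → (seq x n ℚ.+ c) ℚ.* seq x n) (seq-fromℕ r n))
      (ℚ.*-distribʳ-+ (seq x n) (seq x n) ⟨ r ⟩)

    z*r : seq z ⊗ const ⟨ r ⟩ ≋ const ⟨ r ℕ.* r ⟩ ⊹ const ⟨ r ⟩ ⊗ seq x
    z*r = pointwise λ n → trans (cong (λ c → (seq x n ℚ.+ c) ℚ.* ⟨ r ⟩) (seq-fromℕ r n))
      (trans (rearrange (seq x n) ⟨ r ⟩) (cong (ℚ._+ ⟨ r ⟩ ℚ.* seq x n) (sym (⟨⟩-homo-* r r))))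
      where
      rearrange : ∀ a c → (a ℚ.+ c) ℚ.* c ≡ c ℚ.* c ℚ.+ c ℚ.* a
      rearrange = solve 2 (λ a c → (a :+ c) :* c := c :* c :+ c :* a) refl
        where open ℚSolver

  -- Adding r x to both sides gives (x + r) x ≤ (x + r) r, and the positive factor `z` = x + r
  -- cancels.
  square≼⇒≼ : seq x ⊗ seq x ≼ const ⟨ r ℕ.* r ⟩ → seq x ≼ const ⟨ r ⟩
  square≼⇒≼ h = ⊗-cancelˡ z 0<z (≼-trans (≼-reflexive z*x)
    (≼-trans (⊹-mono h ≼-refl) (≼-reflexive (≋-sym z*r))))

  ≼square⇒≼ : const ⟨ r ℕ.* r ⟩ ≼ seq x ⊗ seq x → const ⟨ r ⟩ ≼ seq x
  ≼square⇒≼ h = ⊗-cancelˡ z 0<z (≼-trans (≼-reflexive z*r)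
    (≼-trans (⊹-mono h ≼-refl) (≼-reflexive (≋-sym z*x))))

ratioℚ-nonNeg : ∀ m d 0<d → 0ℚ ℚ.≤ ratioℚ m d 0<d
ratioℚ-nonNeg m d 0<d = *-cancelʳ-≤ᵠ (0<⟨⟩ 0<d)
  (subst₂ ℚ._≤_ (sym (ℚ.*-zeroˡ ⟨ d ⟩)) (sym (ratioℚ-*-cancel m d 0<d)) (0≤⟨⟩ m))

ratioℚ-mono : ∀ {m m′} d 0<d → m ℕ.≤ m′ → ratioℚ m d 0<d ℚ.≤ ratioℚ m′ d 0<d
ratioℚ-mono {m} {m′} d 0<d m≤m′ = *-cancelʳ-≤ᵠ (0<⟨⟩ 0<d)
  (subst₂ ℚ._≤_ (sym (ratioℚ-*-cancel m d 0<d)) (sym (ratioℚ-*-cancel m′ d 0<d)) (⟨⟩-mono-≤ m≤m′))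

ratio-≃-recip : ∀ x (0<x : 0ℝ < x) r 0<r → seq x ≼ const ⟨ r ⟩ → const ⟨ r ⟩ ≼ seq x →
  ratio 1 r 0<r ≃ recip x 0<x
ratio-≃-recip x 0<x r 0<r x≼r r≼x = recip-unique x 0<x (ratio 1 r 0<r)
  (begin
    seq x ⊗ seq (ratio 1 r 0<r)        ≈⟨ ⊗-congˡ (seq x) (ratio≋ 1 r 0<r) ⟩
    seq x ⊗ const (ratioℚ 1 r 0<r)     ≲⟨ ⊗-monoʳ (const-multiplier (ratioℚ-nonNeg 1 r 0<r)) x≼r ⟩
    const ⟨ r ⟩ ⊗ const (ratioℚ 1 r 0<r) ≈⟨ r*1/r≋1 ⟩
    const 1ℚ                            ∎)
  (begin
    const 1ℚ                            ≈⟨ ≋-sym r*1/r≋1 ⟩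
    const ⟨ r ⟩ ⊗ const (ratioℚ 1 r 0<r) ≲⟨ ⊗-monoʳ (const-multiplier (ratioℚ-nonNeg 1 r 0<r)) r≼x ⟩
    seq x ⊗ const (ratioℚ 1 r 0<r)     ≈⟨ ⊗-congˡ (seq x) (≋-sym (ratio≋ 1 r 0<r)) ⟩
    seq x ⊗ seq (ratio 1 r 0<r)        ∎)
  where
  open ≼-Reasoning
  r*1/r≋1 : const ⟨ r ⟩ ⊗ const (ratioℚ 1 r 0<r) ≋ const 1ℚ
  r*1/r≋1 = pointwise λ _ → trans (ℚ.*-comm ⟨ r ⟩ (ratioℚ 1 r 0<r))
    (trans (ratioℚ-*-cancel 1 r 0<r) ⟨1⟩≡1)

-- Densities of sets of small doubling

-- A non-maximal value is exceeded by at least 1, so refuting every maximum would push `f` beyond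
-- `N`; `d` bounds the distance left. There is no search, since the intended `A`, the subsets of
-- small doubling, is cut out by an inequality of reals.
¬¬-maximum : ∀ {A : Set} (f : A → ℕ) N → (∀ a → f a ℕ.≤ N) → A →
  ¬ ¬ ∃ λ a → ∀ a′ → f a′ ℕ.≤ f a
¬¬-maximum {A} f N f≤N a₀ no-max = go N a₀ (ℕ.m≤n+m N (f a₀))
  where
  go : ∀ d a → N ℕ.≤ f a ℕ.+ d → ⊥
  go d a N≤ = no-max (a , λ a′ → ℕ.≮⇒≥ (larger d a N≤ a′))
    where
    larger : ∀ d a → N ℕ.≤ f a ℕ.+ d → ∀ a′ → ¬ f a ℕ.< f a′
    larger zero    a N≤ a′ a<a′ = ℕ.<-irrefl refl (ℕ.<-≤-trans a<a′
      (ℕ.≤-trans (f≤N a′) (subst (N ℕ.≤_) (ℕ.+-identityʳ (f a)) N≤)))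
    larger (suc d) a N≤ a′ a<a′ = go d a′ (ℕ.≤-trans N≤
      (subst (ℕ._≤ f a′ ℕ.+ d) (sym (ℕ.+-suc (f a) d)) (ℕ.+-monoˡ-≤ d a<a′)))

card-mono : ∀ {n} (S S′ : Subset n) → S ⊆ S′ → card S ℕ.≤ card S′
card-mono S S′ S⊆S′ = card-upper S (elements S′) (∈-elements⁺ S′ ∘ S⊆S′ _)

-- The sumset of a point is the one point x + x, and L ≥ 1. This supplies the starting element for
-- `¬¬-maximum`.
singleton-small-doubling : ∀ (L : Func [1,∞⟩ [1,∞⟩) K {n} (S : Subset n) {x} → x ∈ S → SmallDoubling L K S ⟦ x ∷ [] ⟧
singleton-small-doubling L K S {x} x∈S =
    (x , ∈-⟦⟧⁺ {xs = x ∷ []} (here refl))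
  , (λ y y∈ → contained (∈-⟦⟧⁻ {xs = x ∷ []} y∈))
  , ⌞ (begin
      seq (fromℕ (card (Y ⊞ Y)))      ≈⟨ fromℕ≋ (card (Y ⊞ Y)) ⟩
      const ⟨ card (Y ⊞ Y) ⟩          ≲⟨ ⟨⟩-≼ card-sum ⟩
      const ⟨ card Y ⟩                ≈⟨ pointwise (λ _ → sym (ℚ.*-identityʳ ⟨ card Y ⟩)) ⟩
      const ⟨ card Y ⟩ ⊗ const 1ℚ     ≲⟨ ⊗-monoˡ (⟨⟩-multiplier (card Y)) ⌜ proj₂ (L ⟨$⟩ K) ⌝ ⟩
      const ⟨ card Y ⟩ ⊗ seq l        ≈⟨ ⊗-comm (const ⟨ card Y ⟩) (seq l) ⟩
      seq l ⊗ const ⟨ card Y ⟩        ≈⟨ ≋-sym (*-fromℕ≋ (seq l) (card Y)) ⟩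
      seq l ⊗ seq (fromℕ (card Y))    ∎) ⌟
  where
  open ≼-Reasoning
  l = proj₁ (L ⟨$⟩ K)
  Y = ⟦ x ∷ [] ⟧
  contained : ∀ {y} → y ∈ˡ x ∷ [] → y ∈ S
  contained (here refl) = x∈S
  sums : ∀ {z} → z ∈ Y ⊞ Y → z ∈ˡ (x ⊕ x) ∷ []
  sums z∈ with ∈-⊞⁻ Y Y z∈
  ... | a , b , a∈ , b∈ , refl with ∈-⟦⟧⁻ {xs = x ∷ []} {a} a∈ | ∈-⟦⟧⁻ {xs = x ∷ []} {b} b∈
  ...   | here refl | here refl = here refl
  card-sum : card (Y ⊞ Y) ℕ.≤ card Y
  card-sum = subst (card (Y ⊞ Y) ℕ.≤_) (sym (card-⟦⟧ {xs = x ∷ []} ([] ∷ [])))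
    (card-upper (Y ⊞ Y) ((x ⊕ x) ∷ []) sums)

module _ (r : ℕ) (1≤r : 1 ℕ.≤ r) (K : ℝ≥1) (K≃r² : proj₁ K ≃ fromℕ (r ℕ.^ 2)) where

  private
    k = proj₁ K
    0<k = 0<-from-1≤ {k} (proj₂ K)

    r²≼k : const ⟨ r ℕ.^ 2 ⟩ ≼ seq k
    r²≼k = ≼-trans (≼-reflexive (≋-sym (fromℕ≋ (r ℕ.^ 2)))) ⌜ proj₂ K≃r² ⌝

  blocks≠∅ : ∀ m → Nonempty (blocks m r)
  blocks≠∅ m = card⁺⇒Nonempty (blocks m r)
    (subst (0 ℕ.<_) (sym (card-blocks m r)) (ℕ.*-mono-≤ 1≤r (ℕ.m^n>0 2 m)))

  blocks-HighEnergy : ∀ m → HighEnergy K (blocks m r)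
  blocks-HighEnergy m = ⌞ (begin
    seq (recip k 0<k) ⊗ seq (fromℕ (c ℕ.^ 3))        ≈⟨ *-fromℕ≋ (seq (recip k 0<k)) (c ℕ.^ 3) ⟩
    seq (recip k 0<k) ⊗ const ⟨ c ℕ.^ 3 ⟩            ≲⟨ ⊗-monoˡ (recip-multiplier k 0<k) c³≼kE ⟩
    seq (recip k 0<k) ⊗ (seq k ⊗ const ⟨ e ⟩)        ≈⟨ recip-*-cancel k 0<k (const ⟨ e ⟩) ⟩
    const ⟨ e ⟩                                      ≈⟨ ≋-sym (fromℕ≋ e) ⟩
    seq (fromℕ e)                                    ∎) ⌟
    where
    open ≼-Reasoning
    c = card (blocks m r)
    e = E (blocks m r)
    cube : ∀ r q → r ℕ.* q ℕ.* (r ℕ.* q ℕ.* (r ℕ.* q ℕ.* 1)) ≡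
                   r ℕ.* (r ℕ.* 1) ℕ.* (r ℕ.* (q ℕ.* (q ℕ.* (q ℕ.* 1))))
    cube = solve-∀
    c³≤ : c ℕ.^ 3 ℕ.≤ r ℕ.^ 2 ℕ.* e
    c³≤ = subst (ℕ._≤ r ℕ.^ 2 ℕ.* e)
      (sym (trans (cong (ℕ._^ 3) (card-blocks m r)) (cube r (2 ℕ.^ m))))
      (ℕ.*-monoʳ-≤ (r ℕ.^ 2) (energy-blocks m r))
    c³≼kE : const ⟨ c ℕ.^ 3 ⟩ ≼ seq k ⊗ const ⟨ e ⟩
    c³≼kE = begin
      const ⟨ c ℕ.^ 3 ⟩                      ≲⟨ ⟨⟩-≼ c³≤ ⟩
      const ⟨ r ℕ.^ 2 ℕ.* e ⟩                ≈⟨ ≋-sym (⟨⟩-⊗ (r ℕ.^ 2) e) ⟩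
      const ⟨ r ℕ.^ 2 ⟩ ⊗ const ⟨ e ⟩        ≲⟨ ⊗-monoʳ (⟨⟩-multiplier e) r²≼k ⟩
      seq k ⊗ const ⟨ e ⟩                    ∎

  module _ (L : Func [1,∞⟩ [1,∞⟩) where

    private
      l = proj₁ (L ⟨$⟩ K)
      ℓ = proj₁ (≼-fromℕ l)

    excess : ℕ
    excess = 2 ℕ.* ℓ ℕ.+ r ℕ.* (2 ℕ.* ℓ)

    small-doubling-card : ∀ m Y → SmallDoubling L K (blocks m r) Y → card Y ℕ.≤ 2 ℕ.^ m ℕ.+ excess
    small-doubling-card m Y (_ , Y⊆ , h) = small-doubling⇒small m r Y Y⊆ ℓ
      (⟨⟩-cancel-≤ (const-cancel (begin
        const ⟨ card (Y ⊞ Y) ⟩            ≈⟨ ≋-sym (fromℕ≋ (card (Y ⊞ Y))) ⟩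
        seq (fromℕ (card (Y ⊞ Y)))        ≲⟨ ⌜ h ⌝ ⟩
        seq l ⊗ seq (fromℕ (card Y))      ≈⟨ *-fromℕ≋ (seq l) (card Y) ⟩
        seq l ⊗ const ⟨ card Y ⟩          ≲⟨ ⊗-monoʳ (⟨⟩-multiplier (card Y)) (proj₂ (≼-fromℕ l)) ⟩
        const ⟨ ℓ ⟩ ⊗ const ⟨ card Y ⟩    ≈⟨ ⟨⟩-⊗ ℓ (card Y) ⟩
        const ⟨ ℓ ℕ.* card Y ⟩            ∎)))
      where open ≼-Reasoning

    private
      0<r*suc : ∀ m → 1 ℕ.≤ r ℕ.* suc m
      0<r*suc m = ℕ.*-mono-≤ 1≤r (ℕ.s≤s (ℕ.z≤n {m}))

    Γ≼1/r : ∀ g → IsΓ L K g → seq g ≼ const (ratioℚ 1 r 1≤r)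
    Γ≼1/r g (lower , _) = ≼-1/r g r 1≤r excess λ m →
      ≼-trans (≼-reflexive (≋-sym (*-fromℕ≋ (seq g) (r ℕ.* 2 ℕ.^ m))))
        -- For fixed `m` the goal bounds a real by an integer, so the maximal density, available
        -- only under double negation, may be assumed.
        (≼-const-stable (g * fromℕ (r ℕ.* 2 ℕ.^ m)) ⟨ 2 ℕ.^ m ℕ.+ excess ⟩
          (λ ¬bound → attained m λ max → ¬bound
            (≼-trans (≼-reflexive (*-fromℕ≋ (seq g) (r ℕ.* 2 ℕ.^ m))) (bound m max))))
      where
      open ≼-Reasoning
      Candidate : ℕ → Set
      Candidate m = ∃ (SmallDoubling L K (blocks m r))
      size : ∀ {m} → Candidate m → ℕ
      size (Y , _) = card Y
      Maximal : ℕ → Set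
      Maximal m = ∃ λ (c : Candidate m) → ∀ c′ → size c′ ℕ.≤ size c
      attained : ∀ m → ¬ ¬ Maximal m
      attained m = ¬¬-maximum size (card (blocks m r))
        (λ (Y , _ , Y⊆ , _) → card-mono Y (blocks m r) Y⊆)
        (_ , singleton-small-doubling L K (blocks m r) (proj₂ (blocks≠∅ m)))
      bound : ∀ m → Maximal m → seq g ⊗ const ⟨ r ℕ.* 2 ℕ.^ m ⟩ ≼ const ⟨ 2 ℕ.^ m ℕ.+ excess ⟩
      bound m ((Y , Y-small) , Y-max) = begin
        seq g ⊗ const ⟨ r ℕ.* 2 ℕ.^ m ⟩
          ≈⟨ pointwise (λ n → cong (λ k → seq g n ℚ.* ⟨ k ⟩) (sym (card-blocks m r))) ⟩
        seq g ⊗ const ⟨ N ⟩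
          ≲⟨ ⊗-monoʳ (⟨⟩-multiplier N) (≼-trans ⌜ lower d maxDensity ⌝ (≼-reflexive (ratio≋ (card Y) N 0<N))) ⟩
        const (ratioℚ (card Y) N 0<N) ⊗ const ⟨ N ⟩
          ≈⟨ pointwise (λ _ → ratioℚ-*-cancel (card Y) N 0<N) ⟩
        const ⟨ card Y ⟩
          ≲⟨ ⟨⟩-≼ (small-doubling-card m Y Y-small) ⟩
        const ⟨ 2 ℕ.^ m ℕ.+ excess ⟩ ∎
        where
        S = blocks m r
        N = card S
        0<N = 0<card S (blocks≠∅ m)
        d = ratio (card Y) N 0<N
        maxDensity : MaxDensities L K d
        maxDensity = r ℕ.* suc m , 0<r*suc m , S , blocks≠∅ m , blocks-HighEnergy m
          , (Y , Y-small , ⌞ ≼-refl {seq d} ⌟ , ⌞ ≼-refl {seq d} ⌟)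
          , λ { v (Y′ , Y′-small , v≤ , _) → ⌞ ≼-trans ⌜ v≤ ⌝ (≼-trans (≼-reflexive (ratio≋ (card Y′) N 0<N))
                (≼-trans (const-mono (ratioℚ-mono N 0<N (Y-max (Y′ , Y′-small))))
                  (≼-reflexive (≋-sym (ratio≋ (card Y) N 0<N))))) ⌟ }

    -- Here `Extracts` hands over `Y` itself, so the bound on its size applies directly, with no
    -- maximum to be attained.
    γ≼1/r : ∀ γ → Extracts L γ → seq (proj₁ (γ ⟨$⟩ K)) ≼ const (ratioℚ 1 r 1≤r)
    γ≼1/r γ extract = ≼-1/r g r 1≤r excess λ m →
      let S = blocks m r
          Y , Y-small , h = extract K (r ℕ.* suc m) (0<r*suc m) S (blocks≠∅ m) (blocks-HighEnergy m)
      in begin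
        seq g ⊗ const ⟨ r ℕ.* 2 ℕ.^ m ⟩
          ≈⟨ pointwise (λ n → cong (λ k → seq g n ℚ.* ⟨ k ⟩) (sym (card-blocks m r))) ⟩
        seq g ⊗ const ⟨ card S ⟩              ≈⟨ ≋-sym (*-fromℕ≋ (seq g) (card S)) ⟩
        seq g ⊗ seq (fromℕ (card S))          ≲⟨ ⌜ h ⌝ ⟩
        seq (fromℕ (card Y))                  ≈⟨ fromℕ≋ (card Y) ⟩
        const ⟨ card Y ⟩                      ≲⟨ ⟨⟩-≼ (small-doubling-card m Y Y-small) ⟩
        const ⟨ 2 ℕ.^ m ℕ.+ excess ⟩          ∎
      where
      open ≼-Reasoning
      g = proj₁ (γ ⟨$⟩ K)

-- The contamination scale

-- `Y` consists of the first y vectors in the enumeration, and A omits the first d of them. An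
-- arbitrary segment will do, because `PositiveBound` refers only to inclusion and sizes.
nearly-disjoint : ∀ n {d y} → d ℕ.≤ y → y ℕ.≤ 2 ℕ.^ n →
  ∃ λ (A : Subset n) → ∃ λ (Y : Subset n) →
    card A ℕ.+ d ≡ 2 ℕ.^ n × card Y ≡ y ×
    card (A △ λ _ → true) ℕ.≤ d × card (A ∩ Y) ℕ.≤ y ℕ.∸ d
nearly-disjoint n {d} {y} d≤y y≤ =
    not ∘ D , ⟦ ys ⟧ , card-A , trans (card-⟦⟧ ys-unique) length-ys
  , ℕ.≤-trans (card-mono ((not ∘ D) △ λ _ → true) D △⊆D) (ℕ.≤-reflexive card-D)
  , subst (card ((not ∘ D) ∩ ⟦ ys ⟧) ℕ.≤_) (trans (List.length-drop d ys) (cong (ℕ._∸ d) length-ys))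
      (card-upper ((not ∘ D) ∩ ⟦ ys ⟧) (drop d ys) ∩⊆drop)
  where
  ys = take y (vectors n)
  D = ⟦ take d ys ⟧
  ys-unique = Unique.take⁺ y (vectors-unique n)
  length-ys : length ys ≡ y
  length-ys = trans (List.length-take y (vectors n))
    (ℕ.m≤n⇒m⊓n≡m (subst (y ℕ.≤_) (sym (length-vectors n)) y≤))
  card-D : card D ≡ d
  card-D = trans (card-⟦⟧ (Unique.take⁺ d ys-unique)) (trans (List.length-take d ys)
    (ℕ.m≤n⇒m⊓n≡m (subst (d ℕ.≤_) (sym length-ys) d≤y)))
  card-A : card (not ∘ D) ℕ.+ d ≡ 2 ℕ.^ n
  card-A = trans (ℕ.+-comm (card (not ∘ D)) d)
    (trans (cong (ℕ._+ card (not ∘ D)) (sym card-D)) (card-complement D))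
  △⊆D : ((not ∘ D) △ λ _ → true) ⊆ D
  △⊆D x x∈ with D x
  ... | true = _
  ∩⊆drop : ∀ {x} → x ∈ (not ∘ D) ∩ ⟦ ys ⟧ → x ∈ˡ drop d ys
  ∩⊆drop {x} x∈ = [ (λ x∈take → ⊥-elim (subst T (Equivalence.to Bool.T-not-≡ x∉D) (∈-⟦⟧⁺ x∈take)))
                  , id ]′ (Mem.∈-++⁻ (take d ys) (subst (x ∈ˡ_) (sym (List.take++drop≡id d ys)) (∈-⟦⟧⁻ x∈ys)))
    where
    x∉D = proj₁ (Equivalence.to Bool.T-∧ x∈)
    x∈ys = proj₂ (Equivalence.to Bool.T-∧ x∈)

separated : ∀ x y {D d} → 0 ℕ.< D →
  seq x ⊗ const ⟨ D ⟩ ≼ const ⟨ d ℕ.+ 1 ⟩ → const ⟨ d ℕ.+ 2 ⟩ ≼ seq y ⊗ const ⟨ D ⟩ → x < y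
separated x y {D} {d} 0<D x≼ ≼y =
  -- The unit between d + 1 and d + 2 is split as ¼ + ½ + ¼: the quarters absorb the tolerances of
  -- the two hypotheses, the half is the gap `g` scaled by D.
  let g , 0<g , gD≡½ = shrink ⟨ D ⟩ ½ (0<⟨⟩ 0<D) 0<½
      ¼ = ½ ℚ.* ½
      M , p = ⌞ x≼ ⌟ ¼ (*-pos 0<½ 0<½)
      N , q = ⌞ ≼y ⌟ ¼ (*-pos 0<½ 0<½)
  in g , 0<g , M ℕ.⊔ N , λ n h → *-cancelʳ-≤ᵠ (0<⟨⟩ 0<D) (begin
    (seq x n ℚ.+ g) ℚ.* ⟨ D ⟩             ≡⟨ ℚ.*-distribʳ-+ ⟨ D ⟩ (seq x n) g ⟩
    seq x n ℚ.* ⟨ D ⟩ ℚ.+ g ℚ.* ⟨ D ⟩     ≡⟨ cong (seq x n ℚ.* ⟨ D ⟩ ℚ.+_) gD≡½ ⟩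
    seq x n ℚ.* ⟨ D ⟩ ℚ.+ ½               ≤⟨ ℚ.+-monoˡ-≤ ½ (p n (ℕ.m⊔n≤o⇒m≤o M N h)) ⟩
    ⟨ d ℕ.+ 1 ⟩ ℚ.+ ¼ ℚ.+ ½               ≡⟨ cong (λ a → a ℚ.+ ¼ ℚ.+ ½) (trans (⟨⟩-homo-+ d 1) (cong (⟨ d ⟩ ℚ.+_) ⟨1⟩≡1)) ⟩
    ⟨ d ⟩ ℚ.+ 1ℚ ℚ.+ ¼ ℚ.+ ½              ≡⟨ rearrange ⟨ d ⟩ ⟩
    ⟨ d ⟩ ℚ.+ (1ℚ ℚ.+ 1ℚ) ℚ.- ¼           ≡⟨ cong (ℚ._- ¼) (sym (trans (⟨⟩-homo-+ d 2) (cong (⟨ d ⟩ ℚ.+_) two))) ⟩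
    ⟨ d ℕ.+ 2 ⟩ ℚ.- ¼                     ≤⟨ ℚ.+-monoˡ-≤ (ℚ.- ¼) (q n (ℕ.m⊔n≤o⇒n≤o M N h)) ⟩
    seq y n ℚ.* ⟨ D ⟩ ℚ.+ ¼ ℚ.- ¼         ≡⟨ cancel (seq y n ℚ.* ⟨ D ⟩) ⟩
    seq y n ℚ.* ⟨ D ⟩                     ∎)
  where
  open ℚ.≤-Reasoning
  open ℚSolver
  two : ⟨ 2 ⟩ ≡ 1ℚ ℚ.+ 1ℚ
  two = trans (⟨⟩-homo-+ 1 1) (cong₂ ℚ._+_ ⟨1⟩≡1 ⟨1⟩≡1)
  rearrange : ∀ a → a ℚ.+ 1ℚ ℚ.+ ½ ℚ.* ½ ℚ.+ ½ ≡ a ℚ.+ (1ℚ ℚ.+ 1ℚ) ℚ.- ½ ℚ.* ½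
  rearrange = solve 1 (λ a → a :+ con 1ℚ :+ con (½ ℚ.* ½) :+ con ½ := a :+ (con 1ℚ :+ con 1ℚ) :- con (½ ℚ.* ½)) refl
  cancel : ∀ a → a ℚ.+ ½ ℚ.* ½ ℚ.- ½ ℚ.* ½ ≡ a
  cancel = solve 1 (λ a → a :+ con (½ ℚ.* ½) :- con (½ ℚ.* ½) := a) refl

gap-≼ : ∀ x {ε} N → (∀ n → N ℕ.≤ n → 0ℚ ℚ.+ ε ℚ.≤ seq x n) → const ε ≼ seq x
gap-≼ x {ε} N ε≤x = ⌜ (λ δ 0<δ → N , λ n N≤n → ℚ.≤-trans
  (subst (ℚ._≤ seq x n) (ℚ.+-identityˡ ε) (ε≤x n N≤n)) (p≤p+ε (seq x n) 0<δ)) ⌝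

0≼-scale : ∀ k → const ⟨ 0 ⟩ ≼ s → const ⟨ 0 ⟩ ≼ s ⊗ const ⟨ k ⟩
0≼-scale {s} k 0≼s = begin
  const ⟨ 0 ⟩                  ≈⟨ pointwise (λ _ → trans ⟨0⟩≡0
                                    (trans (sym (ℚ.*-zeroˡ ⟨ k ⟩)) (cong (ℚ._* ⟨ k ⟩) (sym ⟨0⟩≡0)))) ⟩
  const ⟨ 0 ⟩ ⊗ const ⟨ k ⟩    ≲⟨ ⊗-monoʳ (⟨⟩-multiplier k) 0≼s ⟩
  s ⊗ const ⟨ k ⟩              ∎
  where open ≼-Reasoning

card-full : ∀ n → card {n} (λ _ → true) ≡ 2 ℕ.^ n
card-full n = trans (sym (ℕ.+-identityʳ (card {n} B)))
  (trans (cong (card {n} B ℕ.+_) (sym empty)) (card-complement {n} B))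
  where
  B : Subset n
  B _ = true
  empty : card (not ∘ B) ≡ 0
  empty = ℕ.n≤0⇒n≡0 (card-upper (not ∘ B) [] λ ())

PositiveBound⇒ : ∀ g η (bound : PositiveBound g η) n {y d D} → 1 ℕ.≤ n →
  d ℕ.≤ y → y ℕ.≤ 2 ℕ.^ n → D ℕ.+ d ≡ 2 ℕ.^ n → 0 ℕ.< D →
  seq g ⊗ const ⟨ 2 ℕ.^ n ⟩ ≼ const ⟨ y ⟩ → const ⟨ d ⟩ ≼ seq η ⊗ const ⟨ D ⟩ →
  seq (proj₁ bound) ⊗ const ⟨ D ⟩ ≼ const ⟨ y ℕ.∸ d ⟩
PositiveBound⇒ g η (c , _ , c-bound) n {y} {d} {D} 1≤n d≤y y≤Q D+d≡Q 0<D gQ≼y d≼ηD =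
  let A , Y , card-A+d , card-Y , card-A△B , card-A∩Y = nearly-disjoint n d≤y y≤Q
  in apply A Y (ℕ.+-cancelʳ-≡ d (card A) D (trans card-A+d (sym D+d≡Q))) card-Y card-A△B card-A∩Y
  where
  open ≼-Reasoning
  B : Subset n
  B _ = true
  rescale : ∀ s {k k′} → k ≡ k′ → s ⊗ seq (fromℕ k) ≋ s ⊗ const ⟨ k′ ⟩
  rescale s {k} refl = *-fromℕ≋ s k
  apply : ∀ A Y → card A ≡ D → card Y ≡ y → card (A △ B) ℕ.≤ d → card (A ∩ Y) ℕ.≤ y ℕ.∸ d →
    seq c ⊗ const ⟨ D ⟩ ≼ const ⟨ y ℕ.∸ d ⟩
  apply A Y card-A card-Y card-A△B card-A∩Y = begin
    seq c ⊗ const ⟨ D ⟩           ≈⟨ ≋-sym (rescale (seq c) card-A) ⟩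
    seq c ⊗ seq (fromℕ (card A))  ≲⟨ ⌜ c-bound n 1≤n A B Y
                                       (card⁺⇒Nonempty A (subst (0 ℕ.<_) (sym card-A) 0<D))
                                       (λ _ _ → _) ⌞ Y-large ⌟ ⌞ A△B-small ⌟ ⌝ ⟩
    seq (fromℕ (card (A ∩ Y)))    ≈⟨ fromℕ≋ (card (A ∩ Y)) ⟩
    const ⟨ card (A ∩ Y) ⟩        ≲⟨ ⟨⟩-≼ card-A∩Y ⟩
    const ⟨ y ℕ.∸ d ⟩             ∎
    where
    Y-large : seq g ⊗ seq (fromℕ (card B)) ≼ seq (fromℕ (card Y))
    Y-large = begin
      seq g ⊗ seq (fromℕ (card B))  ≈⟨ rescale (seq g) (card-full n) ⟩
      seq g ⊗ const ⟨ 2 ℕ.^ n ⟩     ≲⟨ gQ≼y ⟩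
      const ⟨ y ⟩                   ≈⟨ pointwise (λ _ → cong ⟨_⟩ (sym card-Y)) ⟩
      const ⟨ card Y ⟩              ≈⟨ ≋-sym (fromℕ≋ (card Y)) ⟩
      seq (fromℕ (card Y))          ∎
    A△B-small : seq (fromℕ (card (A △ B))) ≼ seq η ⊗ seq (fromℕ (card A))
    A△B-small = begin
      seq (fromℕ (card (A △ B)))    ≈⟨ fromℕ≋ (card (A △ B)) ⟩
      const ⟨ card (A △ B) ⟩        ≲⟨ ⟨⟩-≼ card-A△B ⟩
      const ⟨ d ⟩                   ≲⟨ d≼ηD ⟩
      seq η ⊗ const ⟨ D ⟩           ≈⟨ ≋-sym (rescale (seq η) card-A) ⟩
      seq η ⊗ seq (fromℕ (card A))  ∎

-- The odds g / (1 - g) as the threshold for η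

module _ (g : ℝ) (0<1-g : 0ℝ < 1ℝ - g) where

  private
    ρ = recip (1ℝ - g) 0<1-g

  odds-upper : ∀ {q} → seq g ≼ seq (1ℝ - g) ⊗ const q → seq (g ÷ (1ℝ - g) [ 0<1-g ]) ≼ const q
  odds-upper {q} h = begin
    seq g ⊗ seq ρ                          ≈⟨ ⊗-comm (seq g) (seq ρ) ⟩
    seq ρ ⊗ seq g                          ≲⟨ ⊗-monoˡ (recip-multiplier (1ℝ - g) 0<1-g) h ⟩
    seq ρ ⊗ (seq (1ℝ - g) ⊗ const q)       ≈⟨ recip-*-cancel (1ℝ - g) 0<1-g (const q) ⟩
    const q                                ∎
    where open ≼-Reasoning

  odds-lower : ∀ {q D} → seq (1ℝ - g) ⊗ const q ≼ seq g ⊗ const ⟨ D ⟩ →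
    const q ≼ seq (g ÷ (1ℝ - g) [ 0<1-g ]) ⊗ const ⟨ D ⟩
  odds-lower {q} {D} h = begin
    const q                                ≈⟨ ≋-sym (recip-*-cancel (1ℝ - g) 0<1-g (const q)) ⟩
    seq ρ ⊗ (seq (1ℝ - g) ⊗ const q)       ≲⟨ ⊗-monoˡ (recip-multiplier (1ℝ - g) 0<1-g) h ⟩
    seq ρ ⊗ (seq g ⊗ const ⟨ D ⟩)          ≈⟨ pointwise (λ n → rearrange (seq ρ n) (seq g n) ⟨ D ⟩) ⟩
    seq g ⊗ seq ρ ⊗ const ⟨ D ⟩            ∎
    where
    open ≼-Reasoning
    rearrange : ∀ i a d → i ℚ.* (a ℚ.* d) ≡ a ℚ.* i ℚ.* d
    rearrange = solve 3 (λ i a d → i :* (a :* d) := a :* i :* d) refl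
      where open ℚSolver

  -- Cleared of the denominator: (1 - g)(d + 2) ≤ g Q - g (d + 2) = g D - 2 g ≤ g D, using Q = D +
  -- d.
  ≼odds : ∀ {d D Q} → const ⟨ 0 ⟩ ≼ seq g → D ℕ.+ d ≡ Q →
    const ⟨ d ℕ.+ 2 ⟩ ≼ seq g ⊗ const ⟨ Q ⟩ →
    const ⟨ d ℕ.+ 2 ⟩ ≼ seq (g ÷ (1ℝ - g) [ 0<1-g ]) ⊗ const ⟨ D ⟩
  ≼odds {d} {D} {Q} 0≼g D+d≡Q d+2≼gQ = odds-lower (begin
    seq (1ℝ - g) ⊗ const ⟨ d ℕ.+ 2 ⟩
      ≈⟨ pointwise (λ i → expand (seq g i) ⟨ d ℕ.+ 2 ⟩) ⟩
    const ⟨ d ℕ.+ 2 ⟩ ⊹ ⊖ (seq g ⊗ const ⟨ d ℕ.+ 2 ⟩)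
      ≲⟨ ⊹-mono d+2≼gQ ≼-refl ⟩
    seq g ⊗ const ⟨ Q ⟩ ⊹ ⊖ (seq g ⊗ const ⟨ d ℕ.+ 2 ⟩)
      ≈⟨ pointwise (λ i → trans
           (cong₂ (λ a b → seq g i ℚ.* a ℚ.- seq g i ℚ.* b)
             (trans (cong ⟨_⟩ (sym D+d≡Q)) (⟨⟩-homo-+ D d)) (⟨⟩-homo-+ d 2))
           (collect (seq g i) ⟨ D ⟩ ⟨ d ⟩ ⟨ 2 ⟩)) ⟩
    seq g ⊗ const ⟨ D ⟩ ⊹ ⊖ (seq g ⊗ const ⟨ 2 ⟩)
      ≲⟨ ⊹-mono (≼-refl {seq g ⊗ const ⟨ D ⟩}) (⊖-anti (0≼-scale 2 0≼g)) ⟩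
    seq g ⊗ const ⟨ D ⟩ ⊹ ⊖ const ⟨ 0 ⟩
      ≈⟨ pointwise (λ i → trans (cong (λ a → seq g i ℚ.* ⟨ D ⟩ ℚ.- a) ⟨0⟩≡0)
           (ℚ.+-identityʳ (seq g i ℚ.* ⟨ D ⟩))) ⟩
    seq g ⊗ const ⟨ D ⟩ ∎)
    where
    open ≼-Reasoning
    open ℚSolver
    expand : ∀ a b → (1ℚ ℚ.- a) ℚ.* b ≡ b ℚ.- a ℚ.* b
    expand = solve 2 (λ a b → (con 1ℚ :- a) :* b := b :- a :* b) refl
    collect : ∀ a p q r → a ℚ.* (p ℚ.+ q) ℚ.- a ℚ.* (q ℚ.+ r) ≡ a ℚ.* p ℚ.- a ℚ.* r
    collect = solve 4 (λ a p q r → a :* (p :+ q) :- a :* (q :+ r) := a :* p :- a :* r) refl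

  -- Were d ≤ η D, the assumed bound would give c D ≤ 4, which fails for large n. Hence η D ≤ d + 1,
  -- while the odds times D are at least d + 2.
  PositiveBound⇒<odds : const ⟨ 0 ⟩ ≼ seq g → seq g ⊗ const ⟨ 2 ⟩ ≼ const ⟨ 1 ⟩ →
    ∀ η → const ⟨ 0 ⟩ ≼ seq η → PositiveBound g η → η < g ÷ (1ℝ - g) [ 0<1-g ]
  PositiveBound⇒<odds 0≼g 2g≼1 η 0≼η pb@(c , (ε , 0<ε , N , ε≤c) , _) =
    -- 5 is one more than the bound 4 on the size of A ∩ Y; as D ≥ h, it follows that c D ≥ 5.
    let m , 5≤εh = archimedean ε 0<ε 5
        n = suc m
        h = 2 ℕ.^ m
        h+h≡Q = cong (h ℕ.+_) (sym (ℕ.+-identityʳ h))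
        gQ≼h = halve h h+h≡Q
        y , y≤Q , gQ≼y , y-2≼gQ = nat-approx (g * fromℕ (2 ℕ.^ n)) (2 ℕ.^ n)
          (≼-trans (0≼-scale (2 ℕ.^ n) 0≼g) (≼-reflexive (≋-sym (*-fromℕ≋ (seq g) (2 ℕ.^ n)))))
          (≼-trans (≼-reflexive (*-fromℕ≋ (seq g) (2 ℕ.^ n)))
            (≼-trans gQ≼h (⟨⟩-≼ (subst (h ℕ.≤_) h+h≡Q (ℕ.m≤m+n h h)))))
    in Conclusion.conclude n h y (ℕ.s≤s ℕ.z≤n) h+h≡Q (ℕ.m^n>0 2 m) 5≤εh gQ≼h y≤Q
         (≼-trans (≼-reflexive (≋-sym (*-fromℕ≋ (seq g) (2 ℕ.^ n)))) gQ≼y)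
         (≼-trans y-2≼gQ (≼-reflexive (*-fromℕ≋ (seq g) (2 ℕ.^ n))))
    where
    open ≼-Reasoning
    odds = g ÷ (1ℝ - g) [ 0<1-g ]

    ε≼c : const ε ≼ seq c
    ε≼c = gap-≼ c N ε≤c

    halve : ∀ h {Q} → h ℕ.+ h ≡ Q → seq g ⊗ const ⟨ Q ⟩ ≼ const ⟨ h ⟩
    halve h {Q} h+h≡Q = begin
      seq g ⊗ const ⟨ Q ⟩
        ≈⟨ pointwise (λ i → trans (cong (seq g i ℚ.*_) Q≡2h) (sym (ℚ.*-assoc (seq g i) ⟨ 2 ⟩ ⟨ h ⟩))) ⟩
      seq g ⊗ const ⟨ 2 ⟩ ⊗ const ⟨ h ⟩
        ≲⟨ ⊗-monoʳ (⟨⟩-multiplier h) 2g≼1 ⟩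
      const ⟨ 1 ⟩ ⊗ const ⟨ h ⟩
        ≈⟨ pointwise (λ _ → trans (cong (ℚ._* ⟨ h ⟩) ⟨1⟩≡1) (ℚ.*-identityˡ ⟨ h ⟩)) ⟩
      const ⟨ h ⟩ ∎
      where
      Q≡2h : ⟨ Q ⟩ ≡ ⟨ 2 ⟩ ℚ.* ⟨ h ⟩
      Q≡2h = trans (cong ⟨_⟩ (trans (sym h+h≡Q) (cong (h ℕ.+_) (sym (ℕ.+-identityʳ h))))) (⟨⟩-homo-* 2 h)

    module Conclusion n h y (1≤n : 1 ℕ.≤ n) (h+h≡Q : h ℕ.+ h ≡ 2 ℕ.^ n) (0<h : 0 ℕ.< h)
      (5≤εh : ⟨ 5 ⟩ ℚ.≤ ε ℚ.* ⟨ h ⟩) (gQ≼h : seq g ⊗ const ⟨ 2 ℕ.^ n ⟩ ≼ const ⟨ h ⟩)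
      (y≤Q : y ℕ.≤ 2 ℕ.^ n) (gQ≼y : seq g ⊗ const ⟨ 2 ℕ.^ n ⟩ ≼ const ⟨ y ⟩)
      (y-2≼gQ : const ⟨ y ℕ.∸ 2 ⟩ ≼ seq g ⊗ const ⟨ 2 ℕ.^ n ⟩)
      where
      d D : ℕ
      -- The rounding gives y - 2 ≤ g Q. Two further units make this d + 2 ≤ g Q, one unit above the
      -- d + 1 that bounds η D.
      d = y ℕ.∸ 4
      D = 2 ℕ.^ n ℕ.∸ d

      d≤h : d ℕ.≤ h
      d≤h = ⟨⟩-cancel-≤ (const-cancel (≼-trans (⟨⟩-≼ (ℕ.∸-monoʳ-≤ y (ℕ.s≤s (ℕ.s≤s ℕ.z≤n))))
        (≼-trans y-2≼gQ gQ≼h)))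

      D+d≡Q : D ℕ.+ d ≡ 2 ℕ.^ n
      D+d≡Q = ℕ.m∸n+n≡m (ℕ.≤-trans (ℕ.m∸n≤m y 4) y≤Q)

      h≤D : h ℕ.≤ D
      h≤D = ℕ.+-cancelʳ-≤ d h D (ℕ.≤-trans (ℕ.+-monoʳ-≤ h d≤h)
        (ℕ.≤-reflexive (trans h+h≡Q (sym D+d≡Q))))

      0<D : 0 ℕ.< D
      0<D = ℕ.≤-trans 0<h h≤D

      d⋠ηD : ¬ const ⟨ d ⟩ ≼ seq η ⊗ const ⟨ D ⟩
      d⋠ηD d≼ηD = ℕ.<⇒≱ (ℕ.n<1+n 4) (⟨⟩-cancel-≤ (const-cancel (begin
        const ⟨ 5 ⟩                 ≲⟨ const-mono 5≤εh ⟩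
        const ε ⊗ const ⟨ h ⟩       ≲⟨ ⊗-monoˡ (const-multiplier (ℚ.<⇒≤ 0<ε)) (⟨⟩-≼ h≤D) ⟩
        const ε ⊗ const ⟨ D ⟩       ≲⟨ ⊗-monoʳ (⟨⟩-multiplier D) ε≼c ⟩
        seq c ⊗ const ⟨ D ⟩         ≲⟨ PositiveBound⇒ g η pb n 1≤n (ℕ.m∸n≤m y 4) y≤Q D+d≡Q 0<D gQ≼y d≼ηD ⟩
        const ⟨ y ℕ.∸ d ⟩           ≲⟨ ⟨⟩-≼ (ℕ.m≤n+o⇒m∸n≤o y d
                                         (ℕ.≤-trans (ℕ.m≤n+m∸n y 4) (ℕ.≤-reflexive (ℕ.+-comm 4 d)))) ⟩
        const ⟨ 4 ⟩                 ∎)))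

      conclude : η < odds
      conclude with d ℕ.≟ 0
      -- When g Q is so small that the subtraction gives 0, η ≥ 0 alone yields d ≤ η D, and the
      -- assumed bound is absurd.
      ... | yes d≡0 = contradiction
        (subst (λ k → const ⟨ k ⟩ ≼ seq η ⊗ const ⟨ D ⟩) (sym d≡0) (0≼-scale D 0≼η)) d⋠ηD
      ... | no d≢0 = [ (λ d≼ → contradiction (≼-trans d≼ (≼-reflexive (*-fromℕ≋ (seq η) D))) d⋠ηD)
                     , (λ ≼d+1 → separated η odds 0<D
                         (≼-trans (≼-reflexive (≋-sym (*-fromℕ≋ (seq η) D))) ≼d+1)
                         (≼odds 0≼g D+d≡Q (≼-trans (⟨⟩-≼ d+2≤y-2) y-2≼gQ)))
                     ]′ (locate (η * fromℕ D) (⟨⟩-mono-< (ℕ.m<m+n d {1} ℕ.z<s)))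
        where
        d+2≤y-2 : d ℕ.+ 2 ℕ.≤ y ℕ.∸ 2
        d+2≤y-2 = ℕ.m+n≤o⇒m≤o∸n (d ℕ.+ 2) {2} {y} (ℕ.≤-reflexive
          (trans (ℕ.+-assoc d 2 2) (ℕ.m∸n+n≡m {y} {4} (ℕ.<⇒≤ (ℕ.m∸n≢0⇒n<m {y} {4} d≢0)))))

  -- With w = 1 / s, g = w g (s + 1) - w g ≤ w - w g = (1 - g) w.
  odds≼1/s : ∀ s 0<s → seq g ⊗ const ⟨ s ℕ.+ 1 ⟩ ≼ const ⟨ 1 ⟩ →
    seq (g ÷ (1ℝ - g) [ 0<1-g ]) ≼ const (ratioℚ 1 s 0<s)
  odds≼1/s s 0<s gr≼1 = odds-upper (begin
    seq g
      ≈⟨ pointwise (λ i → trans (left (seq g i))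
           (cong (λ a → w ℚ.* (seq g i ℚ.* a) ℚ.- w ℚ.* seq g i) (sym s+1))) ⟩
    const w ⊗ (seq g ⊗ const ⟨ s ℕ.+ 1 ⟩) ⊹ ⊖ (const w ⊗ seq g)
      ≲⟨ ⊹-mono (⊗-monoˡ (const-multiplier (ratioℚ-nonNeg 1 s 0<s)) gr≼1) ≼-refl ⟩
    const w ⊗ const ⟨ 1 ⟩ ⊹ ⊖ (const w ⊗ seq g)
      ≈⟨ pointwise (λ i → trans (cong (λ a → w ℚ.* a ℚ.- w ℚ.* seq g i) ⟨1⟩≡1) (right w (seq g i))) ⟩
    seq (1ℝ - g) ⊗ const w ∎)
    where
    open ≼-Reasoning
    open ℚSolver
    w = ratioℚ 1 s 0<s
    s+1 : ⟨ s ℕ.+ 1 ⟩ ≡ ⟨ s ⟩ ℚ.+ 1ℚ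
    s+1 = trans (⟨⟩-homo-+ s 1) (cong (⟨ s ⟩ ℚ.+_) ⟨1⟩≡1)
    expand : ∀ a w t → w ℚ.* (a ℚ.* (t ℚ.+ 1ℚ)) ℚ.- w ℚ.* a ≡ a ℚ.* (w ℚ.* t)
    expand = solve 3 (λ a w t → w :* (a :* (t :+ con 1ℚ)) :- w :* a := a :* (w :* t)) refl
    left : ∀ a → a ≡ w ℚ.* (a ℚ.* (⟨ s ⟩ ℚ.+ 1ℚ)) ℚ.- w ℚ.* a
    left a = sym (trans (expand a w ⟨ s ⟩)
      (trans (cong (a ℚ.*_) (trans (ratioℚ-*-cancel 1 s 0<s) ⟨1⟩≡1)) (ℚ.*-identityʳ a)))
    right : ∀ w a → w ℚ.* 1ℚ ℚ.- w ℚ.* a ≡ (1ℚ ℚ.- a) ℚ.* w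
    right = solve 2 (λ w a → w :* con 1ℚ :- w :* a := (con 1ℚ :- a) :* w) refl

-- In fact an identity, 1/s = (1 + 1/s) / (s + 1), which singles out 1/(r - 1) as the o(1) term. The
-- two occurrences of 1/s come with different positivity proofs.
ratioℚ-step : ∀ s 0<s 0<s′ r 0<r → s ℕ.+ 1 ≡ r →
  ratioℚ 1 s 0<s ℚ.≤ (1ℚ ℚ.+ ratioℚ 1 s 0<s′) ℚ.* ratioℚ 1 r 0<r
ratioℚ-step s 0<s 0<s′ r 0<r s+1≡r = *-cancelʳ-≤ᵠ (0<⟨⟩ 0<s) (ℚ.≤-reflexive (begin
  ratioℚ 1 s 0<s ℚ.* ⟨ s ⟩                    ≡⟨ ratioℚ-*-cancel 1 s 0<s ⟩
  ⟨ 1 ⟩                                       ≡⟨ sym (ratioℚ-*-cancel 1 r 0<r) ⟩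
  1/r ℚ.* ⟨ r ⟩                                 ≡⟨ cong (1/r ℚ.*_) (trans (cong ⟨_⟩ (sym s+1≡r)) (⟨⟩-homo-+ s 1)) ⟩
  1/r ℚ.* (⟨ s ⟩ ℚ.+ ⟨ 1 ⟩)                     ≡⟨ cong (λ a → 1/r ℚ.* (⟨ s ⟩ ℚ.+ a)) (sym (ratioℚ-*-cancel 1 s 0<s′)) ⟩
  1/r ℚ.* (⟨ s ⟩ ℚ.+ 1/s ℚ.* ⟨ s ⟩)               ≡⟨ rearrange 1/r 1/s ⟨ s ⟩ ⟩
  (1ℚ ℚ.+ 1/s) ℚ.* 1/r ℚ.* ⟨ s ⟩                  ∎))
  where
  open ≡-Reasoning
  1/r = ratioℚ 1 r 0<r
  1/s = ratioℚ 1 s 0<s′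
  rearrange : ∀ v w t → v ℚ.* (t ℚ.+ w ℚ.* t) ≡ (1ℚ ℚ.+ w) ℚ.* v ℚ.* t
  rearrange = solve 3 (λ v w t → v :* (t :+ w :* t) := (con 1ℚ :+ w) :* v :* t) refl
    where open ℚSolver

<⇒≼ : ∀ x y → x < y → seq x ≼ seq y
<⇒≼ x y (ε , 0<ε , N , h) = ⌜ (λ δ 0<δ → N , λ n N≤n → ℚ.≤-trans (p≤p+ε (seq x n) 0<ε)
  (ℚ.≤-trans (h n N≤n) (p≤p+ε (seq y n) 0<δ))) ⌝

-- Equals 1 / (r - 1) for r ≥ 2; this form keeps the denominator positive for every r, as a total
-- sequence requires.
reciprocals : ℕ → ℝ
reciprocals r = ratio 1 (suc (r ℕ.∸ 2)) ℕ.z<s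

reciprocals-TendsTo0 : TendsTo0 reciprocals
reciprocals-TendsTo0 ε (e , 0<e , N , e≤ε) =
  let m , 1≤e2^m = archimedean e 0<e 1
      M = 2 ℕ.^ m
  in 2 ℕ.+ M , λ r M+2≤r →
    let d = suc (r ℕ.∸ 2)
        w = ratioℚ 1 d ℕ.z<s
        M≤d : M ℕ.≤ d
        M≤d = ℕ.m≤n⇒m≤1+n (ℕ.m+n≤o⇒m≤o∸n M (subst (ℕ._≤ r) (ℕ.+-comm 2 M) M+2≤r))
        w≤e : w ℚ.≤ e
        w≤e = *-cancelʳ-≤ᵠ (0<⟨⟩ {d} ℕ.z<s) (subst (ℚ._≤ e ℚ.* ⟨ d ⟩) (sym (ratioℚ-*-cancel 1 d ℕ.z<s))
          (ℚ.≤-trans 1≤e2^m (*-monoˡ-≤ᵠ (ℚ.<⇒≤ 0<e) (⟨⟩-mono-≤ M≤d))))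
        w≋ = ratio≋ 1 d ℕ.z<s
    in ⌞ ≼-trans (⊖-anti e≼ε) (≼-trans (const-mono (ℚ.≤-trans (ℚ.<⇒≤ (ℚ.neg-antimono-< 0<e)) (ratioℚ-nonNeg 1 d ℕ.z<s)))
           (≼-reflexive (≋-sym w≋))) ⌟
     , ⌞ ≼-trans (≼-reflexive w≋) (≼-trans (const-mono w≤e) e≼ε) ⌟
  where
  e≼ε : const e ≼ seq ε
  e≼ε = gap-≼ ε N e≤ε

-- The case K = r²

module _ (L : Func [1,∞⟩ [1,∞⟩) (r : ℕ) (2≤r : 2 ℕ.≤ r) (K : ℝ≥1)
  (K≃r² : proj₁ K ≃ fromℕ (r ℕ.^ 2)) (√K : PositiveSqrt (proj₁ K))
  where

  open PositiveSqrt √K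

  private
    r-1   = r ℕ.∸ 1
    0<r = m<n⇒0<n 2≤r
    0<s = m<n⇒0<n∸m 2≤r
    w   = ratioℚ 1 r 0<r

    s+1≡r : r-1 ℕ.+ 1 ≡ r
    s+1≡r = ℕ.m∸n+n≡m 0<r

    r²≡r*r : r ℕ.^ 2 ≡ r ℕ.* r
    r²≡r*r = cong (r ℕ.*_) (ℕ.*-identityʳ r)

    -- `√` is given only as some positive number with square K, so that it equals `r` has to be
    -- derived, one inequality at a time.
    √≼r : seq √ ≼ const ⟨ r ⟩
    √≼r = square≼⇒≼ √ 0<√ r (begin
      seq √ ⊗ seq √            ≲⟨ ⌜ proj₁ √*√≃x ⌝ ⟩
      seq (proj₁ K)            ≲⟨ ⌜ proj₁ K≃r² ⌝ ⟩
      seq (fromℕ (r ℕ.^ 2))    ≈⟨ fromℕ≋ (r ℕ.^ 2) ⟩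
      const ⟨ r ℕ.^ 2 ⟩        ≈⟨ pointwise (λ _ → cong ⟨_⟩ r²≡r*r) ⟩
      const ⟨ r ℕ.* r ⟩        ∎)
      where open ≼-Reasoning

    r≼√ : const ⟨ r ⟩ ≼ seq √
    r≼√ = ≼square⇒≼ √ 0<√ r (begin
      const ⟨ r ℕ.* r ⟩        ≈⟨ pointwise (λ _ → cong ⟨_⟩ (sym r²≡r*r)) ⟩
      const ⟨ r ℕ.^ 2 ⟩        ≈⟨ ≋-sym (fromℕ≋ (r ℕ.^ 2)) ⟩
      seq (fromℕ (r ℕ.^ 2))    ≲⟨ ⌜ proj₂ K≃r² ⌝ ⟩
      seq (proj₁ K)            ≲⟨ ⌜ proj₂ √*√≃x ⌝ ⟩
      seq √ ⊗ seq √            ∎)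
      where open ≼-Reasoning

    ⟨r⟩-1 : const ⟨ r ⟩ ⊹ const (ℚ.- 1ℚ) ≋ const ⟨ r-1 ⟩
    ⟨r⟩-1 = pointwise λ _ → trans
      (cong (ℚ._- 1ℚ) (trans (cong ⟨_⟩ (sym s+1≡r))
        (trans (⟨⟩-homo-+ r-1 1) (cong (⟨ r-1 ⟩ ℚ.+_) ⟨1⟩≡1))))
      (cancel ⟨ r-1 ⟩)
      where
      cancel : ∀ a → a ℚ.+ 1ℚ ℚ.- 1ℚ ≡ a
      cancel = solve 1 (λ a → a :+ con 1ℚ :- con 1ℚ := a) refl
        where open ℚSolver

    √-1≼s : seq (√ - 1ℝ) ≼ const ⟨ r-1 ⟩
    √-1≼s = ≼-trans (⊹-mono √≼r (≼-refl {const (ℚ.- 1ℚ)})) (≼-reflexive ⟨r⟩-1)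

    s≼√-1 : const ⟨ r-1 ⟩ ≼ seq (√ - 1ℝ)
    s≼√-1 = ≼-trans (≼-reflexive (≋-sym ⟨r⟩-1)) (⊹-mono r≼√ (≼-refl {const (ℚ.- 1ℚ)}))

    w<1 : w ℚ.< 1ℚ
    w<1 = ℚ.*-cancelʳ-<-nonNeg ⟨ r ⟩ {{ℚ.nonNegative (0≤⟨⟩ r)}}
      (subst₂ ℚ._<_ (sym (ratioℚ-*-cancel 1 r 0<r)) (sym (ℚ.*-identityˡ ⟨ r ⟩)) (⟨⟩-mono-< 2≤r))

    w≼ : const w ≼ seq (ratio 1 r 0<r)
    w≼ = ≼-reflexive (≋-sym (ratio≋ 1 r 0<r))

  1/r≃K^-½ : ratio 1 r 0<r ≃ recip √ 0<√
  1/r≃K^-½ = ratio-≃-recip √ 0<√ r 0<r √≼r r≼√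

  private
    w≼K^-½ : const w ≼ seq (recip √ 0<√)
    w≼K^-½ = ≼-trans w≼ ⌜ proj₁ 1/r≃K^-½ ⌝

  Γ≤1/r : ∀ g → IsΓ L K g → g ≤ ratio 1 r 0<r
  Γ≤1/r g isΓ = ⌞ ≼-trans (Γ≼1/r r 0<r K K≃r² L g isΓ) w≼ ⌟

  0<√K-1 : 0ℝ < √ - 1ℝ
  0<√K-1 = pos-const (√ - 1ℝ) (0<⟨⟩ 0<s) s≼√-1

  1/[r-1]≃ : ratio 1 r-1 0<s ≃ recip (√ - 1ℝ) 0<√K-1
  1/[r-1]≃ = ratio-≃-recip (√ - 1ℝ) 0<√K-1 r-1 0<s √-1≼s s≼√-1

  module _ (γ : Func [1,∞⟩ [0,1]) (extracts : Extracts L γ) where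

    private
      γK = proj₁ (γ ⟨$⟩ K)

      γ≼w : seq γK ≼ const w
      γ≼w = γ≼1/r r 0<r K K≃r² L γ extracts

      γr≼1 : seq γK ⊗ const ⟨ r ⟩ ≼ const ⟨ 1 ⟩
      γr≼1 = ≼-trans (⊗-monoʳ (⟨⟩-multiplier r) γ≼w)
        (≼-reflexive (pointwise λ _ → ratioℚ-*-cancel 1 r 0<r))

      2γ≼1 : seq γK ⊗ const ⟨ 2 ⟩ ≼ const ⟨ 1 ⟩
      2γ≼1 = begin
        seq γK ⊗ const ⟨ 2 ⟩     ≲⟨ ⊗-monoʳ (⟨⟩-multiplier 2) γ≼w ⟩
        const w ⊗ const ⟨ 2 ⟩    ≲⟨ ⊗-monoˡ (const-multiplier (ratioℚ-nonNeg 1 r 0<r)) (⟨⟩-≼ 2≤r) ⟩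
        const w ⊗ const ⟨ r ⟩    ≈⟨ pointwise (λ _ → ratioℚ-*-cancel 1 r 0<r) ⟩
        const ⟨ 1 ⟩              ∎
        where open ≼-Reasoning

      ⟨0⟩≼ : ∀ {x} → 0ℝ ≤ x → const ⟨ 0 ⟩ ≼ seq x
      ⟨0⟩≼ 0≤x = ≼-trans (≼-reflexive (pointwise λ _ → ⟨0⟩≡0)) ⌜ 0≤x ⌝

    γ≤K^-½ : γK ≤ recip √ 0<√
    γ≤K^-½ = ⌞ ≼-trans γ≼w w≼K^-½ ⌟

    0<1-γK : 0ℝ < 1ℝ - γK
    0<1-γK = pos-const (1ℝ - γK) {1ℚ ℚ.- w}
      (subst (ℚ._< 1ℚ ℚ.- w) (ℚ.+-inverseʳ w) (ℚ.+-monoˡ-< (ℚ.- w) w<1))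
      (⊹-mono (≼-refl {const 1ℚ}) (⊖-anti γ≼w))

    bound<odds : ∀ η → 0ℝ ≤ η → PositiveBound γK η → η < γK ÷ (1ℝ - γK) [ 0<1-γK ]
    bound<odds η 0≤η = PositiveBound⇒<odds γK 0<1-γK (⟨0⟩≼ {γK} (proj₁ (proj₂ (γ ⟨$⟩ K)))) 2γ≼1 η (⟨0⟩≼ {η} 0≤η)

    odds≼ : seq (γK ÷ (1ℝ - γK) [ 0<1-γK ]) ≼ const (ratioℚ 1 r-1 0<s)
    odds≼ = odds≼1/s γK 0<1-γK r-1 0<s (subst (λ k → seq γK ⊗ const ⟨ k ⟩ ≼ const ⟨ 1 ⟩) (sym s+1≡r) γr≼1)

    odds≤1/[r-1] : γK ÷ (1ℝ - γK) [ 0<1-γK ] ≤ ratio 1 r-1 0<s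
    odds≤1/[r-1] = ⌞ ≼-trans odds≼ (≼-reflexive (≋-sym (ratio≋ 1 r-1 0<s))) ⌟

    bound≤ : ∀ η → 0ℝ ≤ η → PositiveBound γK η → η ≤ (1ℝ + reciprocals r) * recip √ 0<√
    bound≤ η 0≤η bound = ⌞ (begin
      seq η                                            ≲⟨ <⇒≼ η odds (bound<odds η 0≤η bound) ⟩
      seq odds                                         ≲⟨ odds≼ ⟩
      const (ratioℚ 1 r-1 0<s)                           ≲⟨ const-mono (step r 2≤r) ⟩
      const (1ℚ ℚ.+ o) ⊗ const w                       ≲⟨ ⊗-monoˡ (const-multiplier 0≤1+o) w≼K^-½ ⟩
      const (1ℚ ℚ.+ o) ⊗ seq (recip √ 0<√)             ≈⟨ pointwise (λ n → cong (λ a → (1ℚ ℚ.+ a) ℚ.* seq (recip √ 0<√) n)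
                                                             (sym (seq-ratio 1 (suc (r ℕ.∸ 2)) ℕ.z<s n))) ⟩
      seq ((1ℝ + reciprocals r) * recip √ 0<√)         ∎) ⌟
      where
      open ≼-Reasoning
      odds = γK ÷ (1ℝ - γK) [ 0<1-γK ]
      o = ratioℚ 1 (suc (r ℕ.∸ 2)) ℕ.z<s
      0≤1+o : 0ℚ ℚ.≤ 1ℚ ℚ.+ o
      0≤1+o = ℚ.+-mono-≤ {0ℚ} {1ℚ} (ℚ.<⇒≤ 0<1) (ratioℚ-nonNeg 1 (suc (r ℕ.∸ 2)) ℕ.z<s)
      -- Once r is matched as `suc (suc k)`, both `r ∸ 1` and `suc (r ∸ 2)` compute to `suc k`.
      step : ∀ r (2≤r : 2 ℕ.≤ r) → ratioℚ 1 (r ℕ.∸ 1) (m<n⇒0<n∸m 2≤r) ℚ.≤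
        (1ℚ ℚ.+ ratioℚ 1 (suc (r ℕ.∸ 2)) ℕ.z<s) ℚ.* ratioℚ 1 r (m<n⇒0<n 2≤r)
      step (suc zero) (ℕ.s≤s ())
      step (suc (suc k)) 2≤r = ratioℚ-step (suc k) (m<n⇒0<n∸m 2≤r) ℕ.z<s (suc (suc k)) (m<n⇒0<n 2≤r) (ℕ.+-comm (suc k) 1)

theorem8p5 :
  (L : Func [1,∞⟩ [1,∞⟩) →
  (∀ r (2≤r : 2 ℕ.≤ r) (K : ℝ≥1) → proj₁ K ≃ fromℕ (r ℕ.^ 2) →
    (√K : PositiveSqrt (proj₁ K)) →
    let open PositiveSqrt √K
        1/r  = ratio 1 r (m<n⇒0<n 2≤r)
        K^-½ = recip √ 0<√
    in (∀ g → IsΓ L K g → g ≤ 1/r) × 1/r ≃ K^-½)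
  ×
  (∀ (γ : Func [1,∞⟩ [0,1]) → Extracts L γ →
    (∀ r (2≤r : 2 ℕ.≤ r) (K : ℝ≥1) → proj₁ K ≃ fromℕ (r ℕ.^ 2) →
      (√K : PositiveSqrt (proj₁ K)) →
      let open PositiveSqrt √K
          K^-½    = recip √ 0<√
          γK      = proj₁ (γ ⟨$⟩ K)
          1/[r-1] = ratio 1 (r ℕ.∸ 1) (m<n⇒0<n∸m 2≤r)
      in γK ≤ K^-½
       × Σ (0ℝ < 1ℝ - γK) (λ 0<1-γK →
           (∀ η → 0ℝ ≤ η → PositiveBound γK η → η < γK ÷ (1ℝ - γK) [ 0<1-γK ])
           × γK ÷ (1ℝ - γK) [ 0<1-γK ] ≤ 1/[r-1])
       × Σ (0ℝ < √ - 1ℝ) (λ 0<√K-1 → 1/[r-1] ≃ recip (√ - 1ℝ) 0<√K-1))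
    ×
    (∃ λ (o : ℕ → ℝ) → TendsTo0 o ×
      (∀ r → 2 ℕ.≤ r → (K : ℝ≥1) → proj₁ K ≃ fromℕ (r ℕ.^ 2) →
        (√K : PositiveSqrt (proj₁ K)) →
        let open PositiveSqrt √K
            K^-½ = recip √ 0<√
        in ∀ η → 0ℝ ≤ η → PositiveBound (proj₁ (γ ⟨$⟩ K)) η → η ≤ (1ℝ + o r) * K^-½)))
theorem8p5 L =
  (λ r 2≤r K K≃r² √K → Γ≤1/r L r 2≤r K K≃r² √K , 1/r≃K^-½ L r 2≤r K K≃r² √K)
  , λ γ extracts →
    (λ r 2≤r K K≃r² √K →
        γ≤K^-½ L r 2≤r K K≃r² √K γ extracts
      , (0<1-γK L r 2≤r K K≃r² √K γ extracts
        , bound<odds L r 2≤r K K≃r² √K γ extracts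
        , odds≤1/[r-1] L r 2≤r K K≃r² √K γ extracts)
      , (0<√K-1 L r 2≤r K K≃r² √K , 1/[r-1]≃ L r 2≤r K K≃r² √K))
    , (reciprocals , reciprocals-TendsTo0
      , λ r 2≤r K K≃r² √K → bound≤ L r 2≤r K K≃r² √K γ extracts)
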